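{- Let $n\ge2$ and let $a,b\ge 1$ be integers. There exists a bijection $\phi_n^b:\mathrm{sPF}(K_{n+1}^{a,b})\longrightarrow\mathcal{U}_n^b$ such that for all $\mathcal{P}\in\mathrm{sPF}(K_{n+1}^{a,b})$, \[ \mathrm{rsum}(\mathcal{P})+\omega(r)+1=\kappa(K_n^b,T)+\sum_{e\in E(T)}\ell(e), \] where $T=\phi_n^b(\mathcal{P})$ (with its edge labelling $\ell$ and root weight $\omega(r)$) and $r$ is the root of $T$.
   Context: $\mathbb{N}=\{0,1,2,\dots\}$, $[n]=\{1,\dots,n\}$. $K_{n+1}^{a,b}$ is the complete multigraph on $V=\{0,1,\dots,n\}$ with root $0$, having exactly $a$ edges between $0$ and each $i\in[n]$ and exactly $b$ edges between any two distinct $i,j\in[n]$. $K_n^b=K_{n+1}^{a,b}-\{0\}$ is the complete multigraph on $[n]$ with $b$ edges between any two distinct vertices. Spherical parking functions: let $R=\mathbb{K}[x_1,\dots,x_n]$ over a field $\mathbb{K}$. For an undirected loopless (multi)graph $G$ on $V$ with $a_{ij}$ edges between $i$ and $j$, and $\emptyset\ne A\subseteq[n]$, put $d_A(i)=\sum_{j\in V\setminus A}a_{ij}$ and $m_A=\prod_{i\in A}x_i^{d_A(i)}$. Let $\mathcal{M}_G=\langle m_A:\emptyset\neq A\subseteq[n]\rangle$ and $\mathcal{M}_G^{(k)}=\langle m_A:\emptyset\ne A\subseteq[n],\ |A|\le k+1\rangle$ for $0\le k\le n-1$. Then $\mathrm{sPF}(G)=\{\mathcal{P}\in\mathbb{N}^n:\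 \mathbf{x}^{\mathcal{P}}\in\mathcal{M}_G\setminus\mathcal{M}_G^{(n-2)}\}$. The genus of $G$ is $g(G)=|E(G)|-|V(G)|+1$, and $\mathrm{rsum}(\mathcal{P})=g(G)-\sum_{i\in[n]}\mathcal{P}(i)$ (here with $G=K_{n+1}^{a,b}$). A rooted labelled tree on $[n]$ is uprooted if its root is larger than all children of the root. $\mathcal{U}_n^b$ is the set of uprooted trees $T$ on $[n]$ equipped with an edge labelling $\ell:E(T)\to\{0,1,\dots,b-1\}$ and a weight $\omega(r)\in\{0,1,\dots,b-1\}$ assigned to the root $r$ of $T$. $\kappa$-number: for a rooted spanning tree $T$ of a (multi)graph $H$, $\kappa(H,T)=\sum|E(\mathrm{par}_T(i),j)|$, summed over all pairs $(i,j)$ of non-root vertices such that $i$ is an ancestor of $j$ in $T$ and $i>j$, where $\mathrm{par}_T(i)$ is the parent of $i$ and $|E(u,v)|$ is the number of edges of $H$ between $u$ and $v$. -}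

module Defs where

open import Algebra.Apartness.Bundles using (HeytingField)
open import Data.Empty using (⊥-elim)
open import Data.Fin using (Fin; zero; suc; toℕ) renaming (_<_ to _<ᶠ_)
open import Data.Fin.Properties using (_≟_; _<?_)
open import Data.Fin.Subset using (Subset; Nonempty; outside; ∁; ∣_∣)
open import Data.Fin.Subset.Properties using (_∈?_)
open import Data.Integer using (ℤ; +_; _-_) renaming (_+_ to _+ℤ_)
open import Data.List using (List; []; _∷_; _++_; foldr; cartesianProductWith)
open import Data.Nat using (ℕ; zero; suc; _+_; _∸_; _≤_)
open import Data.Nat.Properties using (+-*-semiring)
open import Data.Product using (Σ-syntax; ∃; _×_; _,_; proj₁)
open import Data.Vec using (Vec; _∷_; tabulate; lookup; zipWith)
open import Function using (_∘_)
open import Level using (0ℓ) renaming (_⊔_ to _⊔ˡ_)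
open import Relation.Binary.Bundles using (Setoid)
open import Relation.Binary.Construct.Closure.ReflexiveTransitive using (Star; ε; _◅_)
open import Relation.Binary.Construct.Closure.Transitive using (TransClosure; [_]; _∷_)
open import Relation.Binary.PropositionalEquality using (_≡_; _≢_; refl; sym; trans; setoid)
open import Relation.Nullary using (Dec; yes; no)
open import Relation.Nullary.Decidable using (map′; ¬?; _×-dec_)
open import Relation.Unary using (Pred; _∈_; _∖_)

import Data.Nat.Properties as ℕₚ
import Data.Vec.Properties as Vecₚ
import Relation.Binary.Construct.On as On

open import Algebra.Properties.Semiring.Sum +-*-semiring public using (sum; sum-syntax)

-- Summand restricted to the indices satisfying a decidable condition.
when : ∀ {p} {P : Set p} → Dec P → (P → ℕ) → ℕ
when (yes p) f = f p
when (no  _) f = 0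

------------------------------------------------------------------------
-- Multigraphs

record Multigraph (m : ℕ) : Set where
  field
    mult     : Fin m → Fin m → ℕ
    mult-sym : ∀ i j → mult i j ≡ mult j i
    loopless : ∀ i → mult i i ≡ 0

open Multigraph public

edgeCount : ∀ {m} → Multigraph m → ℕ
edgeCount {m} G = ∑[ i < m ] ∑[ j < m ] when (i <? j) (λ _ → mult G i j)

genus : ∀ {m} → Multigraph m → ℤ
genus {m} G = (+ edgeCount G - + m) +ℤ + 1

-- The complete multigraph on [n]; i : Fin n stands for the vertex toℕ i + 1.
completeMult : ∀ n → ℕ → Fin n → Fin n → ℕ
completeMult n b i j = when (¬? (i ≟ j)) (λ _ → b)

complete : ∀ n → ℕ → Multigraph n
complete n b = record
  { mult     = completeMult n b
  ; mult-sym = symmetric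
  ; loopless = noLoops
  }
  where
  symmetric : ∀ i j → completeMult n b i j ≡ completeMult n b j i
  symmetric i j with i ≟ j | j ≟ i
  ... | yes _   | yes _   = refl
  ... | yes i≡j | no  j≢i = ⊥-elim (j≢i (sym i≡j))
  ... | no  i≢j | yes j≡i = ⊥-elim (i≢j (sym j≡i))
  ... | no  _   | no  _   = refl

  noLoops : ∀ i → completeMult n b i i ≡ 0
  noLoops i with i ≟ i
  ... | yes _   = refl
  ... | no  i≢i = ⊥-elim (i≢i refl)

-- The complete multigraph on {0, …, n}: the root 0 is zero, and i ∈ [n] is
-- embedded by suc, so deleting the root gives complete n b definitionally.
rootedCompleteMult : ∀ n → ℕ → ℕ → Fin (suc n) → Fin (suc n) → ℕ
rootedCompleteMult n a b zero    zero    = 0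
rootedCompleteMult n a b zero    (suc j) = a
rootedCompleteMult n a b (suc i) zero    = a
rootedCompleteMult n a b (suc i) (suc j) = mult (complete n b) i j

rootedComplete : ∀ n → ℕ → ℕ → Multigraph (suc n)
rootedComplete n a b = record
  { mult     = rootedCompleteMult n a b
  ; mult-sym = symmetric
  ; loopless = noLoops
  }
  where
  symmetric : ∀ i j → rootedCompleteMult n a b i j ≡ rootedCompleteMult n a b j i
  symmetric zero    zero    = refl
  symmetric zero    (suc j) = refl
  symmetric (suc i) zero    = refl
  symmetric (suc i) (suc j) = mult-sym (complete n b) i j

  noLoops : ∀ i → rootedCompleteMult n a b i i ≡ 0
  noLoops zero    = refl
  noLoops (suc i) = loopless (complete n b) i

------------------------------------------------------------------------
-- The polynomial ring 𝕂[x₁, …, xₙ]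

module Polynomials {c ℓ₁ ℓ₂} (𝕂 : HeytingField c ℓ₁ ℓ₂) (n : ℕ) where

  private module 𝕂 = HeytingField 𝕂

  -- A polynomial is a formal finite sum of terms (coefficient , exponent);
  -- repeated exponents and zero coefficients are allowed, and equality is
  -- equality of all coefficients.
  Poly : Set c
  Poly = List (𝕂.Carrier × Vec ℕ n)

  coeff : Poly → Vec ℕ n → 𝕂.Carrier
  coeff []            e = 𝕂.0#
  coeff ((k , d) ∷ p) e with Vecₚ.≡-dec ℕₚ._≟_ d e
  ... | yes _ = k 𝕂.+ coeff p e
  ... | no  _ = coeff p e

  infix 4 _≈ₚ_
  _≈ₚ_ : Poly → Poly → Set ℓ₁
  p ≈ₚ q = ∀ e → coeff p e 𝕂.≈ coeff q e

  0ₚ : Poly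
  0ₚ = []

  infixl 6 _+ₚ_
  _+ₚ_ : Poly → Poly → Poly
  _+ₚ_ = _++_

  infixl 7 _*ₚ_
  _*ₚ_ : Poly → Poly → Poly
  _*ₚ_ = cartesianProductWith λ (k , d) (l , e) → k 𝕂.* l , zipWith _+_ d e

  x^ : Vec ℕ n → Poly
  x^ e = (𝕂.1# , e) ∷ []

  -- The ideal generated by a family g: all finite sums ∑ fⱼ g(iⱼ).
  ⟨_⟩ : ∀ {i} {I : Set i} → (I → Poly) → Pred Poly (c ⊔ˡ ℓ₁ ⊔ˡ i)
  ⟨_⟩ {I = I} g p =
    Σ[ fs ∈ List (Poly × I) ] p ≈ₚ foldr (λ (f , i) q → f *ₚ g i +ₚ q) 0ₚ fs

------------------------------------------------------------------------
-- Spherical parking functions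

-- outside ∷ A is A ⊆ [n] regarded as a subset of V = {0, …, n}.
outDegree : ∀ {n} → Multigraph (suc n) → Subset n → Fin n → ℕ
outDegree {n} G A i =
  ∑[ j < suc n ] when (j ∈? ∁ (outside ∷ A)) (λ _ → mult G (suc i) j)

module _ {c ℓ₁ ℓ₂} (𝕂 : HeytingField c ℓ₁ ℓ₂) {n : ℕ} (G : Multigraph (suc n)) where

  open Polynomials 𝕂 n

  monomial : Subset n → Poly
  monomial A = x^ (tabulate λ i → when (i ∈? A) (λ _ → outDegree G A i))

  parkingIdeal : Pred Poly (c ⊔ˡ ℓ₁)
  parkingIdeal = ⟨ (λ (A : Σ[ A ∈ Subset n ] Nonempty A) → monomial (proj₁ A)) ⟩

  skeletonIdeal : ℕ → Pred Poly (c ⊔ˡ ℓ₁)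
  skeletonIdeal k =
    ⟨ (λ (A : Σ[ A ∈ Subset n ] (Nonempty A × ∣ A ∣ ≤ suc k)) → monomial (proj₁ A)) ⟩

  -- Only meaningful for n ≥ 2, where n ∸ 2 is n - 2.
  sPF : Pred (Vec ℕ n) (c ⊔ˡ ℓ₁)
  sPF 𝒫 = x^ 𝒫 ∈ parkingIdeal ∖ skeletonIdeal (n ∸ 2)

  sPF-setoid : Setoid (c ⊔ˡ ℓ₁) 0ℓ
  sPF-setoid = On.setoid {B = ∃ sPF} (setoid (Vec ℕ n)) proj₁

rsum : ∀ {n} → Multigraph (suc n) → Vec ℕ n → ℤ
rsum G 𝒫 = genus G - + sum (lookup 𝒫)

------------------------------------------------------------------------
-- Rooted labelled trees on [n]

NonRoot : ∀ {n} → Fin n → Set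
NonRoot r = ∃ λ i → i ≢ r

∑-nonRoot : ∀ {n} (r : Fin n) → (NonRoot r → ℕ) → ℕ
∑-nonRoot {n} r f = ∑[ i < n ] when (¬? (i ≟ r)) (λ i≢r → f (i , i≢r))

-- j ⟶ i when i is the parent of j.
ParentRel : ∀ {n} {r : Fin n} → (NonRoot r → Fin n) → Fin n → Fin n → Set
ParentRel {r = r} par j i = Σ[ j≢r ∈ j ≢ r ] par (j , j≢r) ≡ i

-- A rooted tree given by its parent map. That every vertex is joined to the
-- root by a chain of parents gives connectedness and excludes cycles.
record RootedTree (n : ℕ) : Set where
  field
    root    : Fin n
    parent  : NonRoot root → Fin n
    toRoot  : ∀ i → Star (ParentRel parent) i root

  -- The edge {j , parent j} is represented by its child endpoint j.
  Edge : Set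
  Edge = NonRoot root

  Ancestor : Fin n → Fin n → Set
  Ancestor i j = TransClosure (ParentRel parent) j i

  ancestor? : ∀ i j → Dec (Ancestor i j)
  ancestor? i j = search (toRoot j)
    where
    search : ∀ {j} → Star (ParentRel parent) j root → Dec (Ancestor i j)
    search ε = no λ where
      [ r≢r , _ ]     → r≢r refl
      ((r≢r , _) ∷ _) → r≢r refl
    search (_◅_ {j = k} (j≢r , refl) path) with k ≟ i
    ... | yes refl = yes [ j≢r , refl ]
    ... | no  k≢i  = map′ ((j≢r , refl) ∷_) (λ where
      [ _ , k≡i ]        → ⊥-elim (k≢i k≡i)
      ((_ , refl) ∷ k⟶⁺i) → k⟶⁺i) (search path)

  Uprooted : Set
  Uprooted = ∀ j → parent j ≡ root → proj₁ j <ᶠ root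

κ : ∀ {n} → Multigraph n → RootedTree n → ℕ
κ H T =
  ∑-nonRoot root λ i → ∑-nonRoot root λ j →
    when (ancestor? (proj₁ i) (proj₁ j) ×-dec (proj₁ j <? proj₁ i))
         (λ _ → mult H (parent i) (proj₁ j))
  where open RootedTree T

record 𝒰 (n b : ℕ) : Set where
  field
    tree     : RootedTree n
  open RootedTree tree public
  field
    uprooted : Uprooted
    label    : Edge → Fin b
    weight   : Fin b

  labelSum : ℕ
  labelSum = ∑-nonRoot root (toℕ ∘ label)

-- Equality of the data (root, parents, labels, weight), ignoring proofs.
record _≈ᵤ_ {n b} (S T : 𝒰 n b) : Set where
  private
    module S = 𝒰 S
    module T = 𝒰 T
  field
    root-≡   : S.root ≡ T.root
    parent-≡ : ∀ i p q → S.parent (i , p) ≡ T.parent (i , q)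
    label-≡  : ∀ i p q → S.label (i , p) ≡ T.label (i , q)
    weight-≡ : S.weight ≡ T.weight

𝒰-setoid : ℕ → ℕ → Setoid 0ℓ 0ℓ
𝒰-setoid n b = record
  { Carrier       = 𝒰 n b
  ; _≈_           = _≈ᵤ_
  ; isEquivalence = record
    { refl  = record { root-≡ = refl ; parent-≡ = λ _ _ _ → refl
                     ; label-≡ = λ _ _ _ → refl ; weight-≡ = refl }
    ; sym   = λ e → record
        { root-≡   = sym (root-≡ e)
        ; parent-≡ = λ i p q → sym (parent-≡ e i q p)
        ; label-≡  = λ i p q → sym (label-≡ e i q p)
        ; weight-≡ = sym (weight-≡ e) }
    ; trans = λ e f → record
        { root-≡   = trans (root-≡ e) (root-≡ f)
        ; parent-≡ = λ i p q → let m = λ i≡r → p (trans i≡r (sym (root-≡ e))) in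
            trans (parent-≡ e i p m) (parent-≡ f i m q)
        ; label-≡  = λ i p q → let m = λ i≡r → p (trans i≡r (sym (root-≡ e))) in
            trans (label-≡ e i p m) (label-≡ f i m q)
        ; weight-≡ = trans (weight-≡ e) (weight-≡ f) }
    }
  }
  where open _≈ᵤ_

{-# OPTIONS --safe #-}
module Submission where

-- Write 𝒫(i) = a + b q(i) + c(i) with 0 ≤ c(i) < b.  Then 𝒫 is a spherical parking
-- function iff every nonempty proper A ⊂ [n] contains some i with q(i) < n - |A|, whatever
-- the remainders c are.  They become the root weight c(r) and the edge labels b - 1 - c(j),
-- and it remains to match q with an uprooted tree T such that ∑ q plus the number of
-- inversions of T not involving the root is (n - 1)(n - 2) / 2.
--
-- The root r is the largest zero of q; on the remaining n - 1 vertices q is an ordinary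
-- parking function, and the rest of T is found by burning depth-first, trying the
-- vertices in decreasing order.  The first child x of the root is the largest remaining
-- zero, so x < r is exactly the condition of being uprooted.  In terms of T,
--   q(j) = (preorder position of j, r having 0) - 1
--          - (number of ancestors i ≠ r of j with i > j),
-- which is computed recursively by entries.

open import Defs
open import Algebra.Apartness.Bundles using (HeytingField)
open import Data.Empty using (⊥; ⊥-elim)
open import Data.Bool using (true; false)
open import Data.Fin using (Fin; zero; suc; toℕ; opposite) renaming (_<_ to _<ᶠ_; _≤_ to _≤ᶠ_)
open import Data.Fin.Properties using (_≟_; _<?_; all?)
open import Data.Fin.Subset using (Subset; Nonempty; inside; outside; ∁; ∣_∣) renaming (_∈_ to _∈ˢ_; _∉_ to _∉ˢ_; ⊤ to ⊤ˢ)
open import Data.Fin.Subset.Properties using (_∈?_)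
open import Data.Integer using (+_; _-_) renaming (_+_ to _+ℤ_)
open import Data.List using (List; []; _∷_; _++_; map; length; tabulate; allFin; filter; foldr)
open import Data.List.Membership.Propositional using (_∈_)
open import Data.List.Membership.Propositional.Properties using (∈-++⁻; ∈-++⁺ˡ; ∈-++⁺ʳ; ∈-tabulate⁺; ∈-tabulate⁻; ∈-filter⁺; ∈-filter⁻; ∈-∃++)
open import Data.List.Properties using (map-++; map-∘; map-id; map-cong; map-id-local; map-tabulate; length-map; length-++; length-tabulate; tabulate-cong; ++-assoc; ++-identityʳ; ∷-injectiveˡ; ∷-injectiveʳ)
open import Data.List.Relation.Binary.Permutation.Propositional using (_↭_; ↭-refl; ↭-sym; ↭-trans; ↭-reflexive; prep; swap; ↭⇒↭ₛ)
open import Data.List.Relation.Binary.Permutation.Propositional.Properties using (All-resp-↭; ∈-resp-↭; ↭-length; map⁺; drop-∷; ++⁺ˡ; ↭-map-inv; shift)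
open import Data.List.Relation.Unary.All as All using (All; []; _∷_)
open import Data.List.Relation.Unary.AllPairs as AllPairs using (AllPairs; []; _∷_)
open import Data.List.Relation.Unary.Any using (here; there)
open import Data.List.Relation.Unary.Unique.Propositional using (Unique)
open import Data.Nat using (ℕ; zero; suc; _+_; _*_; _∸_; _≤_; _<_; _/_; _%_; z≤n; s≤s; NonZero; >-nonZero)
open import Data.Nat.DivMod using (_mod_)
open import Data.Nat.ListAction using () renaming (sum to sumˡ)
open import Data.Nat.ListAction.Properties using (sum-++; sum-↭)
open import Data.Nat.Properties using (+-*-semiring; ≤-refl; ≤-reflexive; ≤-trans)
open import Data.Nat.Tactic.RingSolver using (solve-∀)
open import Data.Product using (Σ-syntax; ∃; _×_; _,_; proj₁; proj₂)
open import Data.Sum using (_⊎_; inj₁; inj₂)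
open import Data.Unit using (⊤; tt)
open import Data.Vec using (Vec; lookup; zipWith)
open import Function using (_∘_; id)
open import Function.Bundles using (Bijection)
open import Relation.Binary.Construct.Closure.ReflexiveTransitive using (Star; ε; _◅_)
open import Relation.Binary.Construct.Closure.Transitive using (TransClosure; [_]; _∷_)
open import Relation.Binary.PropositionalEquality using (_≡_; _≢_; refl; sym; trans; cong; cong₂; subst; subst₂; setoid; module ≡-Reasoning)
open import Relation.Nullary using (Dec; yes; no; ¬_; does)
open import Relation.Nullary.Decidable using (¬?; _×-dec_; dec-true; dec-false)
open import Relation.Unary using () renaming (_∈_ to _∈ᵖ_)

open import Algebra.Properties.Semiring.Sum +-*-semiring using (∑-distrib-+; ∑-comm; sum-cong-≗; *-distribˡ-sum; *-distribʳ-sum)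

import Data.Fin.Properties as Finₚ
import Data.Fin.Subset.Properties as Subsetₚ
import Data.Integer.Tactic.RingSolver as ℤSolver
import Data.List.Membership.DecPropositional as DecMembership
import Data.List.Relation.Binary.Permutation.Setoid.Properties as Permₛ
import Data.List.Relation.Unary.All.Properties as Allₚ
import Data.List.Relation.Unary.AllPairs.Properties as AllPairsₚ
import Data.List.Relation.Unary.Unique.Propositional.Properties as Uniqueₚ
import Data.Nat.Divisibility as Divisibility
import Data.Nat.DivMod as DivMod
import Data.Nat.Properties as ℕₚ
import Data.Vec as Vec
import Data.Vec.Properties as Vecₚ

-- A subforest never sees q itself: below `x` the values have already changed, and vertices of later
-- siblings are still in the list. Uniqueness and existence of the forest are therefore both proved
-- with a remainder `B`, all of whose values exceed the size of the forest. This inequality says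
-- that the fire has stopped, since a vertex with value at most the number of burnt vertices could
-- burn next. The decreasing order of siblings preserves it: passing below `x` lowers only labels
-- above `x`, and a later sibling tree would be caught in the subtree of `x` only through a relative
-- value 0 at such a label.
--
-- Pairs (label, value) up to permutation replace functions, so that a subforest on any set of
-- labels is treated like the whole vertex set.
--
-- Sorted forests mediate between lists of values and parent maps: induction needs the former shape,
-- the statement uses the latter, and every rooted tree has exactly one sorted forest. The bijection
-- is obtained from a relation between vectors and trees, so that nothing depends on the membership
-- proofs or on how a tree was built.

private variable n : ℕ

-- Forests and their entries

𝟙 : ∀ {p} {P : Set p} → Dec P → ℕ
𝟙 d = when d (λ _ → 1)

𝟙≤1 : ∀ {P : Set} (d : Dec P) → 𝟙 d ≤ 1
𝟙≤1 (yes _) = s≤s z≤n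
𝟙≤1 (no _)  = z≤n

-- node x s t is the tree with root x and child forest s, followed by the later siblings t of x.
data Forest (n : ℕ) : Set where
  leaf : Forest n
  node : Fin n → Forest n → Forest n → Forest n

size : Forest n → ℕ
size leaf         = 0
size (node x s t) = suc (size s + size t)

labels : Forest n → List (Fin n)
labels leaf         = []
labels (node x s t) = x ∷ labels s ++ labels t

HeadBelow : Fin n → Forest n → Set
HeadBelow x leaf         = ⊤
HeadBelow x (node y _ _) = y ≤ᶠ x

Sorted : Forest n → Set
Sorted leaf         = ⊤
Sorted (node x s t) = HeadBelow x t × Sorted s × Sorted t

Entry : ℕ → Set
Entry n = Fin n × ℕ

-- Hanging a forest below `x` moves it one place later in preorder and adds the ancestor `x`. The
-- entry of `j` changes by 1 - [j < x], which is [x < j] because labels are distinct.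
lift lower : Fin n → Entry n → Entry n
lift  x (j , v) = j , 𝟙 (x <? j) + v
lower x (j , v) = j , v ∸ 𝟙 (x <? j)

raise drop : ℕ → Entry n → Entry n
raise k (j , v) = j , k + v
drop  k (j , v) = j , v ∸ k

-- All `suc (size s)` vertices of the tree at `x` precede `t` in preorder, and none of them is an
-- ancestor of a vertex of `t`.
entries : Forest n → List (Entry n)
entries leaf         = []
entries (node x s t) =
  (x , 0) ∷ map (lift x) (entries s) ++ map (raise (suc (size s))) (entries t)

lower-lift : (x : Fin n) (L : List (Entry n)) → map (lower x) (map (lift x) L) ≡ L
lower-lift x L = trans (sym (map-∘ L))
  (trans (map-cong (λ (j , v) → cong (j ,_) (ℕₚ.m+n∸m≡n (𝟙 (x <? j)) v)) L) (map-id L))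

drop-raise : ∀ k (L : List (Entry n)) → map (drop k) (map (raise k) L) ≡ L
drop-raise k L = trans (sym (map-∘ L))
  (trans (map-cong (λ (j , v) → cong (j ,_) (ℕₚ.m+n∸m≡n k v)) L) (map-id L))

raise-drop : ∀ k (L : List (Entry n)) → All (λ e → k ≤ proj₂ e) L → map (raise k) (map (drop k) L) ≡ L
raise-drop k L k≤L = trans (sym (map-∘ L))
  (map-id-local (All.map (λ {e} k≤v → cong (proj₁ e ,_) (ℕₚ.m+[n∸m]≡n k≤v)) k≤L))

ZerosBelow : Fin n → List (Entry n) → Set
ZerosBelow x = All (λ e → proj₂ e ≡ 0 → proj₁ e ≤ᶠ x)

-- The truncated subtraction in `lower` loses information only at a value 0 with label above `x`;
-- this excludes that case.
𝟙≤ : (x : Fin n) (e : Entry n) → (proj₂ e ≡ 0 → proj₁ e ≤ᶠ x) → 𝟙 (x <? proj₁ e) ≤ proj₂ e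
𝟙≤ x (j , v) z with x <? j
𝟙≤ x (j , zero)  z | yes x<j = ⊥-elim (ℕₚ.<⇒≱ x<j (z refl))
𝟙≤ x (j , suc v) z | yes x<j = s≤s z≤n
... | no _ = z≤n

lift-lower : (x : Fin n) (L : List (Entry n)) → ZerosBelow x L → map (lift x) (map (lower x) L) ≡ L
lift-lower x L zs = trans (sym (map-∘ L))
  (map-id-local (All.map (λ {e} z → cong (proj₁ e ,_) (ℕₚ.m+[n∸m]≡n (𝟙≤ x e z))) zs))

lift-zero : (x j : Fin n) {v : ℕ} → 𝟙 (x <? j) + v ≡ 0 → j ≤ᶠ x
lift-zero x j eq with x <? j
... | no x≮j = ℕₚ.≮⇒≥ x≮j

-- The first root `y` is the largest zero of the forest: below `y` a value can be 0 only at a label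
-- at most `y`, and later siblings have been raised.
head-zeros : (x : Fin n) (t : Forest n) → HeadBelow x t → ZerosBelow x (entries t)
head-zeros x leaf         _   = []
head-zeros x (node y s t) y≤x =
  (λ _ → y≤x) ∷
  Allₚ.++⁺ (Allₚ.map⁺ (All.universal (λ (j , v) eq → ≤-trans (lift-zero y j eq) y≤x) (entries s)))
           (Allₚ.map⁺ (All.universal (λ _ ()) (entries t)))

-- Uniqueness of the sorted forest with given entries

drop-prefix : ∀ {A : Set} (xs : List A) {ys zs} → xs ++ ys ↭ xs ++ zs → ys ↭ zs
drop-prefix []       p = p
drop-prefix (x ∷ xs) p = drop-prefix xs (drop-∷ p)

unique-++ˡ : ∀ {A : Set} (xs : List A) {ys} → Unique (xs ++ ys) → Unique xs
unique-++ˡ []       _       = []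
unique-++ˡ (x ∷ xs) (x∉ ∷ u) = Allₚ.++⁻ˡ xs x∉ ∷ unique-++ˡ xs u

unique-++ʳ : ∀ {A : Set} (xs : List A) {ys} → Unique (xs ++ ys) → Unique ys
unique-++ʳ []       u       = u
unique-++ʳ (x ∷ xs) (_ ∷ u) = unique-++ʳ xs u

unique-disjoint : ∀ {A : Set} (xs : List A) {ys z} → Unique (xs ++ ys) → z ∈ xs → z ∈ ys → ⊥
unique-disjoint (x ∷ xs) (x∉ ∷ u) (here refl) z∈ys = All.lookup (Allₚ.++⁻ʳ xs x∉) z∈ys refl
unique-disjoint (x ∷ xs) (x∉ ∷ u) (there z∈)  z∈ys = unique-disjoint xs u z∈ z∈ys

-- Condition on the vertices left over after `k` have burnt: a value at most `k` would let one more
-- burn.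
Above : ℕ → List (Entry n) → Set
Above k = All (λ e → k < proj₂ e)

no-zero : ∀ {k} {x : Fin n} {L} → Above k L → ¬ ((x , 0) ∈ L)
no-zero k<L x∈L with All.lookup k<L x∈L
... | ()

module _ (x : Fin n) (s t : Forest n) (B : List (Entry n)) where

  tail-entries : List (Entry n)
  tail-entries = map (raise (suc (size s))) (entries t) ++ B

  unlift : map (lower x) (map (lift x) (entries s) ++ tail-entries)
         ≡ entries s ++ map (lower x) tail-entries
  unlift = trans (map-++ (lower x) (map (lift x) (entries s)) _)
      (cong (_++ map (lower x) tail-entries) (lower-lift x (entries s)))

  unraise : map (drop (suc (size s))) tail-entries ≡ entries t ++ map (drop (suc (size s))) B
  unraise = trans (map-++ _ (map (raise (suc (size s))) (entries t)) B)
      (cong (_++ map (drop (suc (size s))) B) (drop-raise (suc (size s)) (entries t)))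

  -- Seen from below `x`, the later siblings are part of the remainder. A raised entry of `t` could
  -- sink to `size s` only from a zero of `t` with label above `x`, which the order of siblings
  -- forbids.
  tail-above : HeadBelow x t → Above (size (node x s t)) B → Above (size s) (map (lower x) tail-entries)
  tail-above h above = Allₚ.map⁺ (Allₚ.++⁺
    (Allₚ.map⁺ (All.map (λ {e} z → raised e (𝟙≤ x e z)) (head-zeros x t h)))
    (All.map (λ {e} k<v → ≤-trans (s≤s (ℕₚ.m≤m+n (size s) (size t)))
      (≤-trans (ℕₚ.∸-monoˡ-≤ 1 k<v) (ℕₚ.∸-monoʳ-≤ (proj₂ e) (𝟙≤1 (x <? proj₁ e))))) above))
    where
    raised : ∀ e → 𝟙 (x <? proj₁ e) ≤ proj₂ e → suc (size s) ≤ suc (size s) + proj₂ e ∸ 𝟙 (x <? proj₁ e)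
    raised e le = ≤-trans (ℕₚ.m≤m+n _ (proj₂ e ∸ 𝟙 (x <? proj₁ e)))
      (≤-reflexive (sym (ℕₚ.+-∸-assoc (suc (size s)) le)))

  rest-above : Above (size (node x s t)) B → Above (size t) (map (drop (suc (size s))) B)
  rest-above above = Allₚ.map⁺ (All.map (λ {e} k<v →
    ≤-trans (≤-reflexive (sym (trans (cong (_∸ suc (size s)) (sym (ℕₚ.+-suc (suc (size s)) (size t))))
        (ℕₚ.m+n∸m≡n (suc (size s)) (suc (size t))))))
      (ℕₚ.∸-monoˡ-≤ (suc (size s)) k<v)) above)

  all-zeros : HeadBelow x t → Above (size (node x s t)) B → ZerosBelow x (entries (node x s t) ++ B)
  all-zeros h above = Allₚ.++⁺ (head-zeros x (node x s t) ≤-refl)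
    (All.map (λ { {_ , zero} () ; {_ , suc _} _ () }) above)

-- The first root is forced, being the largest zero. Lowering by it turns the rest into the entries
-- of its child forest followed by a larger remainder, to which induction applies; cancelling that
-- child forest leaves the later siblings.
entries-unique : (s t : Forest n) {B C : List (Entry n)} → Sorted s → Sorted t →
  Above (size s) B → Above (size t) C → entries s ++ B ↭ entries t ++ C → s ≡ t
entries-unique leaf leaf _ _ _ _ _ = refl
entries-unique leaf (node x t₁ t₂) _ _ B> C> p = ⊥-elim (no-zero B> (∈-resp-↭ (↭-sym p) (here refl)))
entries-unique (node x s₁ s₂) leaf _ _ B> C> p = ⊥-elim (no-zero C> (∈-resp-↭ p (here refl)))
entries-unique (node x s₁ s₂) (node y t₁ t₂) {B} {C} (hs , Ss₁ , Ss₂) (ht , St₁ , St₂) B> C> p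
  with refl ← Finₚ.≤-antisym
    (All.lookup (all-zeros y t₁ t₂ C ht C>) (∈-resp-↭ p (here refl)) refl)
    (All.lookup (all-zeros x s₁ s₂ B hs B>) (∈-resp-↭ (↭-sym p) (here refl)) refl)
  with p₁ ← subst₂ _↭_ (++-assoc (map (lift x) (entries s₁)) _ B)
      (++-assoc (map (lift x) (entries t₁)) _ C) (drop-∷ p)
  with refl ← entries-unique s₁ t₁ Ss₁ St₁ (tail-above x s₁ s₂ B hs B>) (tail-above x t₁ t₂ C ht C>)
    (subst₂ _↭_ (unlift x s₁ s₂ B) (unlift x t₁ t₂ C) (map⁺ (lower x) p₁))
  = cong (node x s₁) (entries-unique s₂ t₂ Ss₂ St₂ (rest-above x s₁ s₂ B B>) (rest-above x s₁ t₂ C C>)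
    (subst₂ _↭_ (unraise x s₁ s₂ B) (unraise x s₁ t₂ C)
      (map⁺ (drop (suc (size s₁))) (drop-prefix (map (lift x) (entries s₁)) p₁))))

-- Existence of the forest by burning

max-zero : (L : List (Entry n)) →
  Above 0 L ⊎ (Σ[ x ∈ Fin n ] Σ[ L′ ∈ List (Entry n) ] L ↭ (x , 0) ∷ L′ × ZerosBelow x L′)
max-zero [] = inj₁ []
max-zero ((j , v) ∷ L) with max-zero L
max-zero ((j , suc v) ∷ L) | inj₁ above = inj₁ (s≤s z≤n ∷ above)
max-zero ((j , zero) ∷ L)  | inj₁ above =
  inj₂ (j , L , ↭-refl , All.map (λ { {_ , zero} () ; {_ , suc _} _ () }) above)
max-zero ((j , suc v) ∷ L) | inj₂ (x , L′ , p , zs) =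
  inj₂ (x , (j , suc v) ∷ L′ , ↭-trans (prep _ p) (swap _ _ ↭-refl) , (λ ()) ∷ zs)
max-zero ((j , zero) ∷ L)  | inj₂ (x , L′ , p , zs) with ℕₚ.≤-total (toℕ j) (toℕ x)
... | inj₁ j≤x = inj₂ (x , (j , 0) ∷ L′ , ↭-trans (prep _ p) (swap _ _ ↭-refl) , (λ _ → j≤x) ∷ zs)
... | inj₂ x≤j = inj₂ (j , (x , 0) ∷ L′ , prep _ p , (λ _ → x≤j) ∷ All.map (λ z e → ≤-trans (z e) x≤j) zs)

++-length-≤ : ∀ {A : Set} (xs ys : List A) → length ys ≤ length (xs ++ ys)
++-length-≤ xs ys = ≤-trans (ℕₚ.m≤n+m _ (length xs)) (≤-reflexive (sym (length-++ xs)))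

head-below : (x : Fin n) (t : Forest n) → ZerosBelow x (entries t) → HeadBelow x t
head-below x leaf         _       = tt
head-below x (node y s t) (z ∷ _) = z refl

-- B collects the entries that never burn; k only bounds the recursion.
burn : ∀ k (L : List (Entry n)) → length L ≤ k →
  Σ[ t ∈ Forest n ] Σ[ B ∈ List (Entry n) ] Sorted t × Above (size t) B × L ↭ entries t ++ B
burn k L len with max-zero L
... | inj₁ above = leaf , L , tt , above , ↭-refl
burn zero    []      len | inj₂ (x , L′ , p , zs) with ↭-length p
... | ()
burn (suc k) L len | inj₂ (x , L′ , p , zs)
  with s , B , Ss , B> , pₛ ← burn k (map (lower x) L′)
         (≤-trans (≤-reflexive (length-map (lower x) L′))
           (ℕₚ.≤-pred (≤-trans (≤-reflexive (sym (↭-length p))) len)))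
  -- What did not burn below `x` does not have `x` as an ancestor, so its values are restored by
  -- `lift` before the burnt vertices are subtracted.
  with t , C , St , C> , pₜ ← burn k (map (drop (suc (size s))) (map (lift x) B))
         (≤-trans (≤-reflexive (trans (length-map (drop (suc (size s))) (map (lift x) B))
             (length-map (lift x) B)))
           (≤-trans (++-length-≤ (entries s) B)
             (≤-trans (≤-reflexive (trans (sym (↭-length pₛ)) (length-map (lower x) L′)))
           (ℕₚ.≤-pred (≤-trans (≤-reflexive (sym (↭-length p))) len)))))
  = node x s t , map (raise (suc (size s))) C
  , (head-below x t (proj₁ (Allₚ.++⁻ (entries t) (All-resp-↭ pₜ zeros))) , Ss , St)
  , Allₚ.map⁺ (All.map (λ {e} lt → ≤-trans (≤-reflexive (sym (ℕₚ.+-suc (suc (size s)) (size t))))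
      (ℕₚ.+-monoʳ-≤ (suc (size s)) lt)) C>)
  , ↭-trans p (prep _ (↭-trans step₁ (↭-trans (++⁺ˡ (map (lift x) (entries s)) step₂)
      (↭-reflexive (sym (++-assoc (map (lift x) (entries s)) _ _))))))
  where
  lifted> : Above (size s) (map (lift x) B)
  lifted> = Allₚ.map⁺ (All.map (λ {e} lt → ≤-trans lt (ℕₚ.m≤n+m (proj₂ e) (𝟙 (x <? proj₁ e)))) B>)
  step₁ : L′ ↭ map (lift x) (entries s) ++ map (lift x) B
  step₁ = subst₂ _↭_ (lift-lower x L′ zs) (map-++ (lift x) (entries s) B) (map⁺ (lift x) pₛ)
  step₂ : map (lift x) B ↭ map (raise (suc (size s))) (entries t) ++ map (raise (suc (size s))) C
  step₂ = subst₂ _↭_ (raise-drop (suc (size s)) _ lifted>) (map-++ (raise (suc (size s))) (entries t) C)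
      (map⁺ (raise (suc (size s))) pₜ)
  -- A label above `x` gained 1 from `lift` and so stays positive after the subtraction. Hence the
  -- next root found is at most `x`, and siblings come out in decreasing order.
  zero-below : ∀ (e : Entry _) → size s < proj₂ e →
    𝟙 (x <? proj₁ e) + proj₂ e ∸ suc (size s) ≡ 0 → proj₁ e ≤ᶠ x
  zero-below (j , v) lt eq with x <? j
  ... | no x≮j = ℕₚ.≮⇒≥ x≮j
  ... | yes _  = ⊥-elim (ℕₚ.<⇒≱ lt (ℕₚ.m∸n≡0⇒m≤n eq))
  zeros : ZerosBelow x (map (drop (suc (size s))) (map (lift x) B))
  zeros = Allₚ.map⁺ (Allₚ.map⁺ (All.map (λ {e} → zero-below e) B>))

labels-entries : (t : Forest n) → map proj₁ (entries t) ≡ labels t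
labels-entries leaf         = refl
labels-entries (node x s t) = cong (x ∷_) (trans (map-++ proj₁ (map (lift x) (entries s)) _)
  (cong₂ _++_ (trans (sym (map-∘ (entries s))) (labels-entries s))
              (trans (sym (map-∘ (entries t))) (labels-entries t))))

length-labels : (t : Forest n) → length (labels t) ≡ size t
length-labels leaf         = refl
length-labels (node x s t) = cong suc (trans (length-++ (labels s))
    (cong₂ _+_ (length-labels s) (length-labels t)))

length-entries : (t : Forest n) → length (entries t) ≡ size t
length-entries t = trans (sym (length-map proj₁ (entries t)))
    (trans (cong length (labels-entries t)) (length-labels t))

-- The sum of the entries

total : List (Entry n) → ℕ
total = sumˡ ∘ map proj₂

total-++ : (K L : List (Entry n)) → total (K ++ L) ≡ total K + total L
total-++ K L = trans (cong sumˡ (map-++ proj₂ K L)) (sum-++ (map proj₂ K) (map proj₂ L))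

total-raise : ∀ k (L : List (Entry n)) → total (map (raise k) L) ≡ length L * k + total L
total-raise k []            = refl
total-raise k ((j , v) ∷ L) = trans (cong (_+_ (k + v)) (total-raise k L)) (lemma k v (length L) (total L))
  where
  lemma : ∀ k v l s → k + v + (l * k + s) ≡ k + l * k + (v + s)
  lemma = solve-∀

below : Fin n → List (Fin n) → ℕ
below x js = sumˡ (map (λ j → 𝟙 (j <? x)) js)

inversions : Forest n → ℕ
inversions leaf         = 0
inversions (node x s t) = below x (labels s) + (inversions s + inversions t)

-- The binomial coefficient of n over 2, here both the sum of the preorder positions 0, ..., n - 1
-- and the number of pairs of vertices.
triangle : ℕ → ℕ
triangle zero    = 0
triangle (suc n) = n + triangle n

triangle-+ : ∀ p q → triangle (p + q) ≡ triangle p + triangle q + q * p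
triangle-+ zero    q = lemma (triangle q) q
  where
  lemma : ∀ t q → t ≡ t + q * 0
  lemma = solve-∀
triangle-+ (suc p) q = trans (cong (_+_ (p + q)) (triangle-+ p q)) (lemma p q (triangle p) (triangle q))
  where
  lemma : ∀ p q x y → p + q + (x + y + q * p) ≡ p + x + y + q * suc p
  lemma = solve-∀

-- Each `j` in the list differs from `x`, so exactly one of x < j and j < x adds 1.
total-lift : (x : Fin n) (L : List (Entry n)) → ¬ (x ∈ map proj₁ L) →
  total (map (lift x) L) + below x (map proj₁ L) ≡ length L + total L
total-lift x []            _   = refl
total-lift x ((j , v) ∷ L) x∉L =
  trans (lemma₁ (𝟙 (x <? j)) v _ (𝟙 (j <? x)) _)
    (trans (cong₂ _+_ (cong (_+ v) one) (total-lift x L (x∉L ∘ there))) (lemma₂ v (length L) (total L)))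
  where
  lemma₁ : ∀ a v s b c → a + v + s + (b + c) ≡ (a + b) + v + (s + c)
  lemma₁ = solve-∀
  lemma₂ : ∀ v l s → 1 + v + (l + s) ≡ suc l + (v + s)
  lemma₂ = solve-∀
  one : 𝟙 (x <? j) + 𝟙 (j <? x) ≡ 1
  one with x <? j | j <? x
  ... | yes x<j | yes j<x = ⊥-elim (ℕₚ.<-asym x<j j<x)
  ... | yes _   | no  _   = refl
  ... | no  _   | yes _   = refl
  ... | no x≮j  | no j≮x  = ⊥-elim (x∉L (here (Finₚ.≤-antisym (ℕₚ.≮⇒≥ j≮x) (ℕₚ.≮⇒≥ x≮j))))

-- An entry is a preorder position minus the number of larger ancestors within `t`; the positions
-- add up to `triangle (size t)` and the subtracted terms to the inversions.
total-entries : (t : Forest n) → Unique (labels t) → total (entries t) + inversions t ≡ triangle (size t)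
total-entries leaf         _          = refl
total-entries (node x s t) (x∉ ∷ uniq) = begin
  total (map (lift x) (entries s) ++ map (raise k) (entries t)) +
      (below x (labels s) + (inversions s + inversions t))
    ≡⟨ cong (_+ (below x (labels s) + (inversions s + inversions t)))
           (total-++ (map (lift x) (entries s)) _) ⟩
  total (map (lift x) (entries s)) + total (map (raise k) (entries t)) +
      (below x (labels s) + (inversions s + inversions t))
    ≡⟨ lemma₁ (total (map (lift x) (entries s))) _ _ (inversions s) (inversions t) ⟩
  (total (map (lift x) (entries s)) + below x (labels s)) + total (map (raise k) (entries t)) +
      (inversions s + inversions t)
    ≡⟨ cong (_+ (inversions s + inversions t)) (cong₂ _+_ lifted (total-raise k (entries t))) ⟩
  (length (entries s) + total (entries s)) + (length (entries t) * k + total (entries t)) +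
      (inversions s + inversions t)
    ≡⟨ cong₂ (λ p q → (p + total (entries s)) + (q * k + total (entries t)) +
           (inversions s + inversions t)) (length-entries s) (length-entries t) ⟩
  (size s + total (entries s)) + (size t * k + total (entries t)) + (inversions s + inversions t)
    ≡⟨ lemma₂ (size s) (total (entries s)) (size t) (total (entries t)) _ _ ⟩
  (size s + size t) + ((total (entries s) + inversions s) +
      (total (entries t) + inversions t) + size t * size s)
    ≡⟨ cong (λ p → (size s + size t) + (p + size t * size s))
         (cong₂ _+_ (total-entries s (unique-++ˡ (labels s) uniq))
             (total-entries t (unique-++ʳ (labels s) uniq))) ⟩
  (size s + size t) + (triangle (size s) + triangle (size t) + size t * size s)
    ≡⟨ cong (_+_ (size s + size t)) (triangle-+ (size s) (size t)) ⟨
  triangle (suc (size s + size t)) ∎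
  where
  open ≡-Reasoning
  k = suc (size s)
  x∉s : ¬ (x ∈ map proj₁ (entries s))
  x∉s x∈s = All.lookup x∉ (∈-++⁺ˡ (subst (x ∈_) (labels-entries s) x∈s)) refl
  lifted : total (map (lift x) (entries s)) + below x (labels s) ≡ length (entries s) + total (entries s)
  lifted = subst (λ L → total (map (lift x) (entries s)) + below x L ≡ length (entries s) + total (entries s))
    (labels-entries s) (total-lift x (entries s) x∉s)
  lemma₁ : ∀ a b c d e → a + b + (c + (d + e)) ≡ (a + c) + b + (d + e)
  lemma₁ = solve-∀
  lemma₂ : ∀ p x q y i j → (p + x) + (q * suc p + y) + (i + j) ≡ (p + q) + ((x + i) + (y + j) + q * p)
  lemma₂ = solve-∀

-- Counting small entries

smaller : ℕ → List (Entry n) → ℕ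
smaller m L = sumˡ (map (λ e → 𝟙 (proj₂ e ℕₚ.<? m)) L)

smaller-++ : ∀ m (K L : List (Entry n)) → smaller m (K ++ L) ≡ smaller m K + smaller m L
smaller-++ m K L = trans (cong sumˡ (map-++ _ K L)) (sum-++ (map _ K) (map _ L))

𝟙-mono : ∀ {P Q : Set} (p : Dec P) (q : Dec Q) → (P → Q) → 𝟙 p ≤ 𝟙 q
𝟙-mono (yes p) (yes _) _ = ≤-refl
𝟙-mono (yes p) (no ¬q) f = ⊥-elim (¬q (f p))
𝟙-mono (no _)  _       _ = z≤n

smaller-lift : ∀ m (x : Fin n) L → smaller m L ≤ smaller (suc m) (map (lift x) L)
smaller-lift m x []            = z≤n
smaller-lift m x ((j , v) ∷ L) =
  ℕₚ.+-mono-≤ (𝟙-mono (v ℕₚ.<? m) (𝟙 (x <? j) + v ℕₚ.<? suc m)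
      (λ v<m → s≤s (≤-trans (ℕₚ.+-monoˡ-≤ v (𝟙≤1 (x <? j))) v<m)))
              (smaller-lift m x L)

smaller-raise : ∀ m k (L : List (Entry n)) → smaller m L ≤ smaller (k + m) (map (raise k) L)
smaller-raise m k []            = z≤n
smaller-raise m k ((j , v) ∷ L) =
  ℕₚ.+-mono-≤ (𝟙-mono (v ℕₚ.<? m) (k + v ℕₚ.<? k + m) (ℕₚ.+-monoʳ-< k)) (smaller-raise m k L)

smaller-≤ : ∀ {m m′} (L : List (Entry n)) → m ≤ m′ → smaller m L ≤ smaller m′ L
smaller-≤ []            _    = z≤n
smaller-≤ {m = m} {m′} ((j , v) ∷ L) m≤m′ =
  ℕₚ.+-mono-≤ (𝟙-mono (v ℕₚ.<? m) (v ℕₚ.<? m′) (λ v<m → ≤-trans v<m m≤m′)) (smaller-≤ L m≤m′)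

-- An entry never exceeds its preorder position, so the first `m` vertices all have entries below
-- `m`. This is the parking condition.
smaller-entries : ∀ m (t : Forest n) → m ≤ size t → m ≤ smaller m (entries t)
smaller-entries zero    t            _   = z≤n
smaller-entries (suc m) (node x s t) (s≤s m≤) = s≤s (≤-trans bound
  (≤-reflexive (sym (smaller-++ (suc m) (map (lift x) (entries s)) _))))
  where
  bound : m ≤ smaller (suc m) (map (lift x) (entries s)) +
      smaller (suc m) (map (raise (suc (size s))) (entries t))
  bound with ℕₚ.≤-total m (size s)
  ... | inj₁ m≤s = ≤-trans (≤-trans (smaller-entries m s m≤s) (smaller-lift m x (entries s))) (ℕₚ.m≤m+n _ _)
  -- The first `suc m` preorder positions now contain `x`, all of `s`, and the first `d` vertices of
  -- `t`.
  ... | inj₂ s≤m = begin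
    m                                          ≡⟨ ℕₚ.m+[n∸m]≡n s≤m ⟨
    size s + d                                 ≤⟨ ℕₚ.+-mono-≤
      (≤-trans (smaller-entries (size s) s ≤-refl)
          (≤-trans (smaller-lift (size s) x (entries s)) (smaller-≤ (map (lift x) (entries s)) (s≤s s≤m))))
      (≤-trans (smaller-entries d t d≤t) (≤-trans (smaller-raise d (suc (size s)) (entries t))
        (≤-reflexive (cong (λ k → smaller (suc k) (map (raise (suc (size s))) (entries t)))
            (ℕₚ.m+[n∸m]≡n s≤m))))) ⟩
    smaller (suc m) (map (lift x) (entries s)) + smaller (suc m) (map (raise (suc (size s))) (entries t)) ∎
    where
    open ℕₚ.≤-Reasoning
    d = m ∸ size s
    d≤t : d ≤ size t
    d≤t = ≤-trans (ℕₚ.∸-monoˡ-≤ (size s) m≤) (≤-reflexive (ℕₚ.m+n∸m≡n (size s) (size t)))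

-- Parking functions and forests

sum-tabulate : (f : Fin n → ℕ) → sumˡ (tabulate f) ≡ sum f
sum-tabulate {zero}  f = refl
sum-tabulate {suc n} f = cong (_+_ (f zero)) (sum-tabulate (f ∘ suc))

-- Here `f` is the indicator of a set disjoint from `A`.
∣∣+sum≤ : (A : Subset n) (f : Fin n → ℕ) → (∀ i → f i ≤ 1) → (∀ i → i ∈ˢ A → f i ≡ 0) → ∣ A ∣ + sum f ≤ n
∣∣+sum≤ Vec.[]            f _   _   = z≤n
∣∣+sum≤ (inside Vec.∷ A)  f f≤1 f≡0 rewrite f≡0 zero Vec.here =
  s≤s (∣∣+sum≤ A (f ∘ suc) (f≤1 ∘ suc) (λ i → f≡0 (suc i) ∘ Vec.there))
∣∣+sum≤ (outside Vec.∷ A) f f≤1 f≡0 =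
  ≤-trans (≤-reflexive (lemma ∣ A ∣ (f zero) _))
    (ℕₚ.+-mono-≤ (f≤1 zero) (∣∣+sum≤ A (f ∘ suc) (f≤1 ∘ suc) (λ i → f≡0 (suc i) ∘ Vec.there)))
  where
  lemma : ∀ a b c → a + (b + c) ≡ b + (a + c)
  lemma = solve-∀

-- The counterpart for a set that covers the complement of `A`.
≤∣∣+sum : (A : Subset n) (f : Fin n → ℕ) → (∀ i → i ∉ˢ A → 1 ≤ f i) → n ≤ ∣ A ∣ + sum f
≤∣∣+sum Vec.[]            f _   = z≤n
≤∣∣+sum (inside Vec.∷ A)  f f≥1 =
  s≤s (≤-trans (≤∣∣+sum A (f ∘ suc) (λ i i∉ → f≥1 (suc i) (λ { (Vec.there i∈) → i∉ i∈ })))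
        (ℕₚ.+-monoʳ-≤ ∣ A ∣ (ℕₚ.m≤n+m _ (f zero))))
≤∣∣+sum (outside Vec.∷ A) f f≥1 =
  ≤-trans (ℕₚ.+-mono-≤ (f≥1 zero (λ ())) (≤∣∣+sum A (f ∘ suc)
      (λ i i∉ → f≥1 (suc i) (λ { (Vec.there i∈) → i∉ i∈ }))))
    (≤-reflexive (lemma ∣ A ∣ (f zero) _))
  where
  lemma : ∀ a b c → b + (a + c) ≡ a + (b + c)
  lemma = solve-∀

graph : (Fin n → ℕ) → List (Entry n)
graph q = tabulate (λ i → i , q i)

∈-graph⁻ : {q : Fin n → ℕ} {e : Entry n} → e ∈ graph q → proj₂ e ≡ q (proj₁ e)
∈-graph⁻ e∈ with _ , refl ← ∈-tabulate⁻ e∈ = refl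

smaller-graph : ∀ m (q : Fin n → ℕ) → smaller m (graph q) ≡ ∑[ i < n ] 𝟙 (q i ℕₚ.<? m)
smaller-graph m q = trans (cong sumˡ (map-tabulate (λ i → i , q i) _)) (sum-tabulate (λ i → 𝟙 (q i ℕₚ.<? m)))

smaller-↭ : ∀ m {K L : List (Entry n)} → K ↭ L → smaller m K ≡ smaller m L
smaller-↭ m p = sum-↭ (map⁺ _ p)

smaller-≤-length : ∀ m (L : List (Entry n)) → smaller m L ≤ length L
smaller-≤-length m []            = z≤n
smaller-≤-length m ((_ , v) ∷ L) = ℕₚ.+-mono-≤ (𝟙≤1 (v ℕₚ.<? m)) (smaller-≤-length m L)

smaller-above : ∀ m (L : List (Entry n)) → Above m L → smaller (suc m) L ≡ 0
smaller-above m []            []        = refl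
smaller-above m ((_ , v) ∷ L) (m<v ∷ L>) with v ℕₚ.<? suc m
... | yes v≤m = ⊥-elim (ℕₚ.<⇒≱ m<v (ℕₚ.≤-pred v≤m))
... | no  _   = smaller-above m L L>

-- These are the prime parking functions, with values counted from 0: for 0 < m < n, more than m
-- values are below m. The set `A` plays the role of the vertices with value at least m = n - |A|.
Prime : (Fin n → ℕ) → Set
Prime {n} q = ∀ A → Nonempty A → ∣ A ∣ < n → ¬ (∀ i → i ∈ˢ A → n ∸ ∣ A ∣ ≤ q i)

record Code (q : Fin n → ℕ) (r : Fin n) (t : Forest n) : Set where
  field
    sorted : Sorted t
    head   : HeadBelow r t
    perm   : graph q ↭ (r , 0) ∷ entries t

  labels-↭ : allFin n ↭ r ∷ labels t
  labels-↭ = subst₂ _↭_ (map-tabulate (λ i → i , q i) proj₁) (cong (r ∷_) (labels-entries t))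
      (map⁺ proj₁ perm)

  sum-entries : sum q ≡ total (entries t)
  sum-entries = trans (sym (trans (cong sumˡ (map-tabulate (λ i → i , q i) proj₂)) (sum-tabulate q)))
    (sum-↭ (map⁺ proj₂ perm))

code-function : {q q′ : Fin n → ℕ} {r : Fin n} {t : Forest n} → Code q r t → Code q′ r t → ∀ i → q i ≡ q′ i
code-function {q′ = q′} c c′ i = ∈-graph⁻ {q = q′}
    (∈-resp-↭ (↭-trans (Code.perm c) (↭-sym (Code.perm c′))) (∈-tabulate⁺ i))

-- Since the first child of the root is at most `r`, the root is the largest zero of `q` and is thus
-- determined.
code-unique : {q : Fin n → ℕ} {r r′ : Fin n} {t t′ : Forest n} → Code q r t → Code q r′ t′ → r ≡ r′ × t ≡ t′
code-unique {r = r} {r′} {t} {t′} c c′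
  with p ← ↭-trans (↭-sym (Code.perm c)) (Code.perm c′)
  with refl ← Finₚ.≤-antisym
    (All.lookup ((λ _ → ≤-refl) ∷ head-zeros r′ t′ (Code.head c′)) (∈-resp-↭ p (here refl)) refl)
    (All.lookup ((λ _ → ≤-refl) ∷ head-zeros r  t  (Code.head c))  (∈-resp-↭ (↭-sym p) (here refl)) refl)
  = refl , entries-unique t t′ (Code.sorted c) (Code.sorted c′) [] []
      (subst₂ _↭_ (sym (++-identityʳ (entries t))) (sym (++-identityʳ (entries t′))) (drop-∷ p))

size-labels : {r : Fin n} {t : Forest n} → allFin n ↭ r ∷ labels t → n ≡ suc (size t)
size-labels {t = t} p = trans (sym (length-tabulate id)) (trans (↭-length p) (cong suc (length-labels t)))

-- For m = n - |A| the root supplies one value below m and the forest at least m more. These m + 1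
-- vertices do not fit outside `A`.
code-prime : {q : Fin n → ℕ} {r : Fin n} {t : Forest n} → Code q r t → Prime q
code-prime {n} {q} {r} {t} c A (i , i∈A) A<n q≥ = ℕₚ.<-irrefl refl (begin-strict
  n                                       ≡⟨ ℕₚ.m+[n∸m]≡n (ℕₚ.<⇒≤ A<n) ⟨
  ∣ A ∣ + m                               <⟨ ℕₚ.+-monoʳ-< ∣ A ∣ enough ⟩
  ∣ A ∣ + ∑[ i < n ] 𝟙 (q i ℕₚ.<? m)      ≤⟨ ∣∣+sum≤ A _ (λ i → 𝟙≤1 (q i ℕₚ.<? m)) none ⟩
  n                                       ∎)
  where
  open ℕₚ.≤-Reasoning
  m = n ∸ ∣ A ∣
  none : ∀ i → i ∈ˢ A → 𝟙 (q i ℕₚ.<? m) ≡ 0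
  none i i∈ with q i ℕₚ.<? m
  ... | yes q<m = ⊥-elim (ℕₚ.<⇒≱ q<m (q≥ i i∈))
  ... | no  _   = refl
  1≤A : 1 ≤ ∣ A ∣
  1≤A = ≤-trans (≤-reflexive (sym (Subsetₚ.∣⁅x⁆∣≡1 i)))
    (Subsetₚ.p⊆q⇒∣p∣≤∣q∣ (λ j∈ → subst (_∈ˢ A) (sym (Subsetₚ.x∈⁅y⁆⇒x≡y i j∈)) i∈A))
  m≤t : m ≤ size t
  m≤t = ≤-trans (ℕₚ.∸-monoʳ-≤ n 1≤A) (≤-reflexive (cong (_∸ 1) (size-labels {t = t} (Code.labels-↭ c))))
  root-small : 1 ≤ 𝟙 (0 ℕₚ.<? m)
  root-small with 0 ℕₚ.<? m
  ... | yes _   = ≤-refl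
  ... | no  0≮m = ⊥-elim (0≮m (ℕₚ.m<n⇒0<n∸m A<n))
  enough : suc m ≤ ∑[ i < n ] 𝟙 (q i ℕₚ.<? m)
  enough = ≤-trans (ℕₚ.+-mono-≤ root-small (smaller-entries m t m≤t))
    (≤-reflexive (trans (sym (smaller-↭ m (Code.perm c))) (smaller-graph m q)))

atLeast : ℕ → (Fin n → ℕ) → Subset n
atLeast m q = Vec.tabulate (λ i → does (m ℕₚ.≤? q i))

∈-atLeast⁺ : ∀ {m} {q : Fin n → ℕ} {i} → m ≤ q i → i ∈ˢ atLeast m q
∈-atLeast⁺ {m = m} {q} {i} m≤q = Vecₚ.lookup⇒[]= i (atLeast m q)
    (trans (Vecₚ.lookup∘tabulate _ i) (dec-true (m ℕₚ.≤? q i) m≤q))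

∈-atLeast⁻ : ∀ {m} {q : Fin n → ℕ} {i} → i ∈ˢ atLeast m q → m ≤ q i
∈-atLeast⁻ {m = m} {q} {i} i∈ with m ℕₚ.≤? q i
... | yes m≤q = m≤q
... | no  m≰q = ⊥-elim (false≢true (trans (sym (dec-false (m ℕₚ.≤? q i) m≰q))
    (trans (sym (Vecₚ.lookup∘tabulate _ i)) (Vecₚ.[]=⇒lookup i∈))))
  where
  false≢true : false ≢ true
  false≢true ()

-- If burning stops early, the vertices with value above `size t` violate primality: at most the
-- root and the `size t` burnt vertices lie outside this set, so each of its values is at least n -
-- |A|.
prime-code : {q : Fin n → ℕ} → 2 ≤ n → Prime q → Σ[ r ∈ Fin n ] Σ[ t ∈ Forest n ] Code q r t
prime-code {suc (suc n)} {q} (s≤s (s≤s z≤n)) prime with max-zero (graph q)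
... | inj₁ q>0 =
  ⊥-elim (prime A (suc zero , Vec.there Subsetₚ.∈⊤) (≤-reflexive (cong suc size-A))
    (λ i _ → ≤-trans (≤-reflexive (trans (cong (suc (suc n) ∸_) size-A) (ℕₚ.m+n∸n≡m 1 n)))
        (All.lookup q>0 (∈-tabulate⁺ {f = λ i → i , q i} i))))
  where
  -- For a set missing a single vertex the bound n - |A| is 1, so a function without zeros violates
  -- primality.
  A = outside Vec.∷ ⊤ˢ {suc n}
  size-A : ∣ A ∣ ≡ suc n
  size-A = Subsetₚ.∣⊤∣≡n (suc n)
prime-code {n@(suc (suc _))} {q} (s≤s (s≤s z≤n)) prime | inj₂ (r , L , p , zs) with burn (length L) L ≤-refl
... | t , []    , St , _  , pₜ = r , t , record
  { sorted = St
  ; head   = head-below r t (All-resp-↭ (↭-trans pₜ (↭-reflexive (++-identityʳ (entries t)))) zs)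
  ; perm   = ↭-trans p (prep _ (↭-trans pₜ (↭-reflexive (++-identityʳ (entries t)))))
  }
... | t , e ∷ B , St , B> , pₜ = ⊥-elim (prime A nonempty proper large)
  where
  m = suc (size t)
  A = atLeast m q
  p′ : graph q ↭ (r , 0) ∷ entries t ++ e ∷ B
  p′ = ↭-trans p (prep _ pₜ)
  few : smaller m (graph q) ≤ m
  few = ≤-trans (≤-reflexive (trans (smaller-↭ m p′) (cong suc (trans (smaller-++ m (entries t) (e ∷ B))
      (trans (cong (_+_ (smaller m (entries t))) (smaller-above (size t) (e ∷ B) B>)) (ℕₚ.+-identityʳ _))))))
    (s≤s (≤-trans (smaller-≤-length m (entries t)) (≤-reflexive (length-entries t))))
  nonempty : Nonempty A
  nonempty = proj₁ e , ∈-atLeast⁺ {q = q} (≤-trans (All.lookup B> (here refl))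
    (≤-reflexive (∈-graph⁻ {q = q} (∈-resp-↭ (↭-sym p′) (there (∈-++⁺ʳ (entries t) (here refl)))))))
  none : ∀ i → i ∈ˢ A → 𝟙 (q i ℕₚ.<? m) ≡ 0
  none i i∈ with q i ℕₚ.<? m
  ... | yes q<m = ⊥-elim (ℕₚ.<⇒≱ q<m (∈-atLeast⁻ {q = q} i∈))
  ... | no  _   = refl
  some : ∀ i → i ∉ˢ A → 1 ≤ 𝟙 (q i ℕₚ.<? m)
  some i i∉ with q i ℕₚ.<? m
  ... | yes _   = ≤-refl
  ... | no  q≮m = ⊥-elim (i∉ (∈-atLeast⁺ {q = q} (ℕₚ.≮⇒≥ q≮m)))
  proper : ∣ A ∣ < n
  proper = ≤-trans (≤-reflexive (ℕₚ.+-comm 1 ∣ A ∣))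
    (≤-trans (ℕₚ.+-monoʳ-≤ ∣ A ∣ (≤-trans (s≤s z≤n)
        (≤-reflexive (trans (sym (smaller-↭ m p′)) (smaller-graph m q)))))
      (∣∣+sum≤ A _ (λ i → 𝟙≤1 (q i ℕₚ.<? m)) none))
  large : ∀ i → i ∈ˢ A → n ∸ ∣ A ∣ ≤ q i
  large i i∈ = ≤-trans (≤-trans (ℕₚ.∸-monoˡ-≤ ∣ A ∣ (≤∣∣+sum A _ some))
      (≤-trans (≤-reflexive (trans (ℕₚ.m+n∸m≡n ∣ A ∣ _) (sym (smaller-graph m q)))) few))
    (∈-atLeast⁻ {q = q} i∈)

function-of-graph : ∀ {m} (g : Fin m → Fin n) (L : List (Entry n)) → map proj₁ L ≡ tabulate g →
  Σ[ q ∈ (Fin m → ℕ) ] tabulate (λ i → g i , q i) ≡ L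
function-of-graph {m = zero}  g []            eq = (λ ()) , refl
function-of-graph {m = suc m} g ((j , v) ∷ L) eq
  with refl ← ∷-injectiveˡ eq
  with q , refl ← function-of-graph (g ∘ suc) L (∷-injectiveʳ eq)
  = (λ { zero → v ; (suc i) → q i }) , refl

-- The permutation that sorts the labels is lifted to the entries; a list whose labels are in
-- standard order is the graph of a function.
forest-code : {r : Fin n} {t : Forest n} → Sorted t → HeadBelow r t → allFin n ↭ r ∷ labels t →
  Σ[ q ∈ (Fin n → ℕ) ] Code q r t
forest-code {n} {r} {t} St ht p
  with L , eq , pL ← ↭-map-inv proj₁ (↭-sym (subst (allFin n ↭_) (cong (r ∷_) (sym (labels-entries t))) p))
  with q , refl ← function-of-graph id L (sym eq) = q , record
  { sorted = St ; head = ht ; perm = ↭-sym pL }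

-- Forests and rooted trees

unique-resp-↭ : ∀ {A : Set} {xs ys : List A} → xs ↭ ys → Unique xs → Unique ys
unique-resp-↭ {A} p = Permₛ.Unique-resp-↭ (setoid A) (↭⇒↭ₛ p)

spanning-unique : {r : Fin n} {t : Forest n} → allFin n ↭ r ∷ labels t → Unique (r ∷ labels t)
spanning-unique p = unique-resp-↭ p (Uniqueₚ.allFin⁺ _)

spanning-nonRoot : {r : Fin n} {t : Forest n} → allFin n ↭ r ∷ labels t → ∀ {j} → j ∈ labels t → j ≢ r
spanning-nonRoot {t = t} p j∈ refl with r∉ ∷ _ ← spanning-unique {t = t} p = All.lookup r∉ j∈ refl

spanning-complete : {r : Fin n} {t : Forest n} → allFin n ↭ r ∷ labels t → ∀ {j} → j ≢ r → j ∈ labels t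
spanning-complete p {j} j≢r with ∈-resp-↭ p (∈-tabulate⁺ j)
... | here  j≡r = ⊥-elim (j≢r j≡r)
... | there j∈  = j∈

Edges : (Fin n → Fin n → Set) → Fin n → Forest n → Set
Edges R v leaf         = ⊤
Edges R v (node x s t) = R x v × Edges R x s × Edges R v t

edges-map : {R S : Fin n → Fin n → Set} (v : Fin n) (t : Forest n) →
  (∀ {j i} → j ∈ labels t → R j i → S j i) → Edges R v t → Edges S v t
edges-map v leaf         f _            = tt
edges-map v (node x s t) f (e , es , et) =
  f (here refl) e , edges-map x s (f ∘ there ∘ ∈-++⁺ˡ) es , edges-map v t (f ∘ there ∘ ∈-++⁺ʳ (labels s)) et

edges-star : {R : Fin n → Fin n → Set} {r : Fin n} (v : Fin n) (t : Forest n) →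
  Edges R v t → Star R v r → ∀ {j} → j ∈ labels t → Star R j r
edges-star v (node x s t) (e , es , et) path (here refl) = e ◅ path
edges-star v (node x s t) (e , es , et) path (there j∈) with ∈-++⁻ (labels s) j∈
... | inj₁ j∈s = edges-star x s es (e ◅ path) j∈s
... | inj₂ j∈t = edges-star v t et path j∈t

_∈ˡ?_ : (j : Fin n) (L : List (Fin n)) → Dec (j ∈ L)
_∈ˡ?_ = DecMembership._∈?_ _≟_

-- `v` stands for the vertex above the forest, and is also the default value at labels that do not
-- occur in it.
parentIn : Fin n → Forest n → Fin n → Fin n
parentIn v leaf         j = v
parentIn v (node x s t) j with j ≟ x | j ∈ˡ? labels s
... | yes _ | _     = v
... | no  _ | yes _ = parentIn x s j
... | no  _ | no  _ = parentIn v t j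

parentIn-edges : (par : Fin n → Fin n) (v : Fin n) (t : Forest n) → Unique (labels t) →
  (∀ {j} → j ∈ labels t → par j ≡ parentIn v t j) → Edges (λ j i → par j ≡ i) v t
parentIn-edges par v leaf         _        _  = tt
parentIn-edges par v (node x s t) (x∉ ∷ u) eq =
  at-x , parentIn-edges par x s (unique-++ˡ (labels s) u) at-s ,
  parentIn-edges par v t (unique-++ʳ (labels s) u) at-t
  where
  at-x : par x ≡ v
  at-x with x ≟ x | eq (here refl)
  ... | yes _   | e = e
  ... | no  x≢x | _ = ⊥-elim (x≢x refl)
  at-s : ∀ {j} → j ∈ labels s → par j ≡ parentIn x s j
  at-s {j} j∈s with j ≟ x | j ∈ˡ? labels s | eq (there (∈-++⁺ˡ j∈s))
  ... | yes refl | _      | _ = ⊥-elim (All.lookup x∉ (∈-++⁺ˡ j∈s) refl)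
  ... | no _     | yes _  | e = e
  ... | no _     | no j∉s | _ = ⊥-elim (j∉s j∈s)
  at-t : ∀ {j} → j ∈ labels t → par j ≡ parentIn v t j
  at-t {j} j∈t with j ≟ x | j ∈ˡ? labels s | eq (there (∈-++⁺ʳ (labels s) j∈t))
  ... | yes refl | _       | _ = ⊥-elim (All.lookup x∉ (∈-++⁺ʳ (labels s) j∈t) refl)
  ... | no _     | yes j∈s | _ = ⊥-elim (unique-disjoint (labels s) u j∈s j∈t)
  ... | no _     | no  _   | e = e

module _ (r : Fin n) (t : Forest n) (p : allFin n ↭ r ∷ labels t) where

  forestParent : NonRoot r → Fin n
  forestParent (j , _) = parentIn r t j

  forest-edges : Edges (ParentRel forestParent) r t
  forest-edges = edges-map r t (λ j∈ e → spanning-nonRoot {t = t} p j∈ , e)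
    (parentIn-edges (parentIn r t) r t (AllPairs.tail (spanning-unique {t = t} p)) (λ _ → refl))

  forestTree : RootedTree n
  forestTree = record
    { root   = r
    ; parent = forestParent
    ; toRoot = λ i → connect i
    }
    where
    connect : ∀ i → Star (ParentRel forestParent) i r
    connect i with i ≟ r
    ... | yes refl = ε
    ... | no  i≢r  = edges-star r t forest-edges ε (spanning-complete {t = t} p i≢r)

-- Decreasing lists of siblings

roots : Forest n → List (Fin n)
roots leaf         = []
roots (node x s t) = x ∷ roots t

roots⊆labels : (t : Forest n) {j : Fin n} → j ∈ roots t → j ∈ labels t
roots⊆labels (node x s t) (here eq)  = here eq
roots⊆labels (node x s t) (there j∈) = there (∈-++⁺ʳ (labels s) (roots⊆labels t j∈))

roots-below : (x : Fin n) (t : Forest n) → Sorted t → HeadBelow x t → All (_≤ᶠ x) (roots t)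
roots-below x leaf         _            _   = []
roots-below x (node y s t) (h , _ , St) y≤x =
  y≤x ∷ All.map (λ z≤y → ≤-trans z≤y y≤x) (roots-below y t St h)

Descending : List (Fin n) → Set
Descending = AllPairs (λ i j → j <ᶠ i)

roots-descending : (t : Forest n) → Sorted t → Unique (labels t) → Descending (roots t)
roots-descending leaf         _            _        = []
roots-descending (node x s t) (h , _ , St) (x∉ ∷ u) =
  All.tabulate (λ j∈ → Finₚ.≤∧≢⇒< (All.lookup (roots-below x t St h) j∈)
    (λ j≡x → All.lookup x∉ (∈-++⁺ʳ (labels s) (roots⊆labels t j∈)) (sym j≡x)))
  ∷ roots-descending t St (unique-++ʳ (labels s) u)

descending-unique : {xs ys : List (Fin n)} → Descending xs → Descending ys →
  (∀ {z} → z ∈ xs → z ∈ ys) → (∀ {z} → z ∈ ys → z ∈ xs) → xs ≡ ys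
descending-unique [] [] _ _ = refl
descending-unique [] (_ ∷ _) _ g with g (here refl)
... | ()
descending-unique (_ ∷ _) [] f _ with f (here refl)
... | ()
descending-unique {xs = x ∷ xs} {y ∷ ys} (x> ∷ dx) (y> ∷ dy) f g with same
  where
  same : x ≡ y
  same with f (here refl) | g (here refl)
  ... | here x≡y  | _          = x≡y
  ... | there _   | here y≡x   = sym y≡x
  ... | there x∈  | there y∈   = ⊥-elim (ℕₚ.<-asym (All.lookup y> x∈) (All.lookup x> y∈))
... | refl = cong (x ∷_) (descending-unique dx dy
    (λ z∈ → below-head x> (f (there z∈)) z∈) (λ z∈ → below-head y> (g (there z∈)) z∈))
  where
  below-head : ∀ {z} {us vs : List (Fin _)} → All (_<ᶠ x) us → z ∈ x ∷ vs → z ∈ us → z ∈ vs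
  below-head x> (here refl) z∈ = ⊥-elim (ℕₚ.<-irrefl refl (All.lookup x> z∈))
  below-head x> (there z∈) _   = z∈

descending : ∀ n → List (Fin n)
descending n = tabulate opposite

∈-descending : (i : Fin n) → i ∈ descending n
∈-descending i = subst (_∈ descending _) (Finₚ.opposite-involutive i) (∈-tabulate⁺ (opposite i))

descending-descending : ∀ n → Descending (descending n)
descending-descending n = AllPairsₚ.tabulate⁺-<
    (λ {i} {j} i<j → subst₂ _<_ (sym (Finₚ.opposite-prop j)) (sym (Finₚ.opposite-prop i))
  (ℕₚ.∸-monoʳ-< (s≤s i<j) (Finₚ.toℕ<n j)))

-- Multiplicities in lists

occ : Fin n → List (Fin n) → ℕ
occ j L = sumˡ (map (λ i → 𝟙 (j ≟ i)) L)

occ-++ : (j : Fin n) (K L : List (Fin n)) → occ j (K ++ L) ≡ occ j K + occ j L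
occ-++ j K L = trans (cong sumˡ (map-++ _ K L)) (sum-++ (map _ K) (map _ L))

𝟙-yes : ∀ {P : Set} (d : Dec P) → P → 𝟙 d ≡ 1
𝟙-yes (yes _) _ = refl
𝟙-yes (no ¬p) p = ⊥-elim (¬p p)

𝟙-no : ∀ {P : Set} (d : Dec P) → ¬ P → 𝟙 d ≡ 0
𝟙-no (yes p) ¬p = ⊥-elim (¬p p)
𝟙-no (no _)  _  = refl

occ-∉ : {j : Fin n} {L : List (Fin n)} → ¬ (j ∈ L) → occ j L ≡ 0
occ-∉ {L = []}    _  = refl
occ-∉ {j = j} {i ∷ L} j∉ = cong₂ _+_ (𝟙-no (j ≟ i) (j∉ ∘ here)) (occ-∉ (j∉ ∘ there))

occ-∈ : {j : Fin n} {L : List (Fin n)} → Unique L → j ∈ L → occ j L ≡ 1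
occ-∈ {j = j} {i ∷ L} (i∉ ∷ u) (here refl) = cong₂ _+_ (𝟙-yes (j ≟ i) refl)
    (occ-∉ (λ j∈ → All.lookup i∉ j∈ refl))
occ-∈ {j = j} {i ∷ L} (i∉ ∷ u) (there j∈)  = cong₂ _+_
    (𝟙-no (j ≟ i) (λ { refl → All.lookup i∉ j∈ refl })) (occ-∈ u j∈)

occ⇒∈ : {j : Fin n} (L : List (Fin n)) → occ j L ≢ 0 → j ∈ L
occ⇒∈ []      nz = ⊥-elim (nz refl)
occ⇒∈ {j = j} (i ∷ L) nz with j ≟ i
... | yes j≡i = here j≡i
... | no  _   = there (occ⇒∈ L nz)

occ⇒↭ : (K L : List (Fin n)) → (∀ j → occ j K ≡ occ j L) → K ↭ L
occ⇒↭ []      []      _  = ↭-refl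
occ⇒↭ []      (x ∷ L) eq with trans (eq x) (cong (_+ occ x L) (𝟙-yes (x ≟ x) refl))
... | ()
occ⇒↭ (x ∷ K) L eq with L₁ , L₂ , refl ← ∈-∃++
    (occ⇒∈ {j = x} L (λ z → ℕₚ.1+n≢0 (trans (cong (_+ occ x K) (sym (𝟙-yes (x ≟ x) refl)))
    (trans (eq x) z)))) =
  ↭-trans (prep x (occ⇒↭ K (L₁ ++ L₂) (λ j → ℕₚ.+-cancelˡ-≡ (𝟙 (j ≟ x)) _ _
    (trans (eq j) (sum-↭ (map⁺ _ (shift x L₁ L₂))))))) (↭-sym (shift x L₁ L₂))

-- The sorted forest of a rooted tree

module Tree (T : RootedTree n) where
  open RootedTree T

  R : Fin n → Fin n → Set
  R = ParentRel parent

  R-functional : ∀ {j i i′} → R j i → R j i′ → i ≡ i′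
  R-functional (_ , refl) (_ , refl) = refl

  R-root : ∀ {i} → ¬ R root i
  R-root (r≢r , _) = r≢r refl

  R? : ∀ j i → Dec (R j i)
  R? j i with j ≟ root
  ... | yes refl = no R-root
  ... | no  j≢r with parent (j , j≢r) ≟ i
  ...   | yes eq = yes (j≢r , eq)
  ...   | no neq = no (neq ∘ proj₂)

  children : Fin n → List (Fin n)
  children v = filter (λ j → R? j v) (descending n)

  children⁺ : ∀ {j v} → R j v → j ∈ children v
  children⁺ {j} {v} e = ∈-filter⁺ (λ j → R? j v) (∈-descending j) e

  children⁻ : ∀ {j v} → j ∈ children v → R j v
  children⁻ {v = v} j∈ = proj₂ (∈-filter⁻ (λ j → R? j v) {xs = descending n} j∈)

  children-descending : ∀ v → Descending (children v)
  children-descending v = AllPairsₚ.filter⁺ (λ j → R? j v) (descending-descending n)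

  children-unique : ∀ v → Unique (children v)
  children-unique v = AllPairs.map (λ { j<i refl → ℕₚ.<-irrefl refl j<i }) (children-descending v)

  -- Below every vertex hangs its complete list of children, in decreasing order. This leaves no
  -- choice, so it serves as a normal form for the tree.
  data Spans : List (Fin n) → Forest n → Set where
    leaf : Spans [] leaf
    node : ∀ {x cs s t} → Spans (children x) s → Spans cs t → Spans (x ∷ cs) (node x s t)

  spans-unique : ∀ {cs s t} → Spans cs s → Spans cs t → s ≡ t
  spans-unique leaf         leaf         = refl
  spans-unique (node ss st) (node us ut) = cong₂ (node _) (spans-unique ss us) (spans-unique st ut)

  edges-parent : ∀ v t → Edges R v t → ∀ {j i} → j ∈ labels t → R j i → i ∈ v ∷ labels t
  edges-parent v (node x s t) (e , es , et) (here refl) e′ = here (R-functional e′ e)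
  edges-parent v (node x s t) (e , es , et) (there j∈) e′ with ∈-++⁻ (labels s) j∈
  ... | inj₁ j∈s = there (∈-x∷ (edges-parent x s es j∈s e′))
    where
    ∈-x∷ : ∀ {i} → i ∈ x ∷ labels s → i ∈ x ∷ labels s ++ labels t
    ∈-x∷ (here eq)  = here eq
    ∈-x∷ (there i∈) = there (∈-++⁺ˡ i∈)
  ... | inj₂ j∈t with edges-parent v t et j∈t e′
  ...   | here eq  = here eq
  ...   | there i∈ = there (there (∈-++⁺ʳ (labels s) i∈))

  edges-roots⁻ : ∀ v t → Edges R v t → ∀ {j} → j ∈ roots t → R j v
  edges-roots⁻ v (node x s t) (e , _ , et) (here refl) = e
  edges-roots⁻ v (node x s t) (e , _ , et) (there j∈)  = edges-roots⁻ v t et j∈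

  -- A vertex that is not a root has its parent inside the forest, where `v` does not occur.
  edges-roots⁺ : ∀ v t → Edges R v t → Unique (v ∷ labels t) → ∀ {j} → j ∈ labels t → R j v → j ∈ roots t
  edges-roots⁺ v (node x s t) _             _                       (here refl) _  = here refl
  edges-roots⁺ v (node x s t) (e , es , et) ((v≢x ∷ v∉) ∷ (_ ∷ u)) (there j∈)  e′ with ∈-++⁻ (labels s) j∈
  ... | inj₂ j∈t = there (edges-roots⁺ v t et (Allₚ.++⁻ʳ (labels s) v∉ ∷ unique-++ʳ (labels s) u) j∈t e′)
  ... | inj₁ j∈s with edges-parent x s es j∈s e′
  ...   | here v≡x = ⊥-elim (v≢x v≡x)
  ...   | there v∈ = ⊥-elim (All.lookup v∉ (∈-++⁺ˡ v∈) refl)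

  roots≡children : ∀ v t → Edges R v t → Unique (v ∷ labels t) → Sorted t →
    (∀ {j} → R j v → j ∈ labels t) → roots t ≡ children v
  roots≡children v t es u St covers = descending-unique
    (roots-descending t St (AllPairs.tail u)) (children-descending v)
    (λ j∈ → children⁺ (edges-roots⁻ v t es j∈))
    (λ j∈ → edges-roots⁺ v t es u (covers (children⁻ j∈)) (children⁻ j∈))

  -- `Edges` only places vertices below their parents; that no child is missing comes from closure
  -- under children. Closure passes to `s` and to `t` because their labels are disjoint and parents
  -- are unique.
  edges-spans : ∀ v t → Edges R v t → Unique (v ∷ labels t) → Sorted t →
    (∀ {j i} → R j i → i ∈ labels t → j ∈ labels t) → Spans (roots t) t
  edges-spans v leaf         _             _                       _              _      = leaf
  edges-spans v (node x s t) (e , es , et) ((v≢x ∷ v∉) ∷ (x∉ ∷ u)) (_ , Ss , St) closed =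
    node (subst (λ cs → Spans cs s) (roots≡children x s es uₛ Ss x-complete)
        (edges-spans x s es uₛ Ss s-closed))
         (edges-spans v t et uₜ St t-closed)
    where
    uₛ : Unique (x ∷ labels s)
    uₛ = Allₚ.++⁻ˡ (labels s) x∉ ∷ unique-++ˡ (labels s) u
    uₜ : Unique (v ∷ labels t)
    uₜ = Allₚ.++⁻ʳ (labels s) v∉ ∷ unique-++ʳ (labels s) u
    -- The parents of x and of the vertices of t lie in v ∷ labels t.
    below-x : ∀ {j i} → R j i → i ∈ x ∷ labels s → j ∈ labels s
    below-x e′ i∈ with closed e′ (weaken i∈)
      where
      weaken : ∀ {i} → i ∈ x ∷ labels s → i ∈ x ∷ labels s ++ labels t
      weaken (here eq)  = here eq
      weaken (there i∈) = there (∈-++⁺ˡ i∈)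
    below-x e′ i∈ | here refl with R-functional e′ e | i∈
    ... | refl | here v≡x = ⊥-elim (v≢x v≡x)
    ... | refl | there v∈ = ⊥-elim (All.lookup v∉ (∈-++⁺ˡ v∈) refl)
    below-x e′ i∈ | there j∈ with ∈-++⁻ (labels s) j∈
    ... | inj₁ j∈s = j∈s
    ... | inj₂ j∈t with edges-parent v t et j∈t e′ | i∈
    ...   | here refl | here v≡x = ⊥-elim (v≢x v≡x)
    ...   | here refl | there v∈ = ⊥-elim (All.lookup v∉ (∈-++⁺ˡ v∈) refl)
    ...   | there i∈t | here refl = ⊥-elim (All.lookup x∉ (∈-++⁺ʳ (labels s) i∈t) refl)
    ...   | there i∈t | there i∈s = ⊥-elim (unique-disjoint (labels s) u i∈s i∈t)
    x-complete : ∀ {j} → R j x → j ∈ labels s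
    x-complete e′ = below-x e′ (here refl)
    s-closed : ∀ {j i} → R j i → i ∈ labels s → j ∈ labels s
    s-closed e′ i∈ = below-x e′ (there i∈)
    t-closed : ∀ {j i} → R j i → i ∈ labels t → j ∈ labels t
    t-closed e′ i∈ with closed e′ (there (∈-++⁺ʳ (labels s) i∈))
    ... | here refl with refl ← R-functional e′ e = ⊥-elim (All.lookup v∉ (∈-++⁺ʳ (labels s) i∈) refl)
    ... | there j∈ with ∈-++⁻ (labels s) j∈
    ...   | inj₂ j∈t = j∈t
    ...   | inj₁ j∈s with edges-parent x s es j∈s e′
    ...     | here refl = ⊥-elim (All.lookup x∉ (∈-++⁺ʳ (labels s) i∈) refl)
    ...     | there i∈s = ⊥-elim (unique-disjoint (labels s) u i∈s i∈)

  record Represents (t : Forest n) : Set where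
    field
      sorted   : Sorted t
      spanning : allFin n ↭ root ∷ labels t
      edges    : Edges R root t

    covers : ∀ {j i} → R j i → j ∈ labels t
    covers (j≢r , _) = spanning-complete {t = t} spanning j≢r

    roots-children : roots t ≡ children root
    roots-children = roots≡children root t edges (spanning-unique {t = t} spanning) sorted covers

    spans : Spans (children root) t
    spans = subst (λ cs → Spans cs t) roots-children
      (edges-spans root t edges (spanning-unique {t = t} spanning) sorted (λ e _ → covers e))

  represents-unique : ∀ {s t} → Represents s → Represents t → s ≡ t
  represents-unique σ τ = spans-unique (Represents.spans σ) (Represents.spans τ)

  -- Siblings decrease, so comparing the root with its first child is enough; this is also why the
  -- converse holds.
  uprooted⇒head : Uprooted → ∀ t → Represents t → HeadBelow root t
  uprooted⇒head up leaf         _ = tt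
  uprooted⇒head up (node x s t) ρ with (x≢r , eq) , _ ← Represents.edges ρ = ℕₚ.<⇒≤ (up (x , x≢r) eq)

  head⇒uprooted : ∀ t → Represents t → HeadBelow root t → Uprooted
  head⇒uprooted t ρ h (j , j≢r) eq = Finₚ.≤∧≢⇒<
    (All.lookup (roots-below root t (Represents.sorted ρ) h)
      (subst (j ∈_) (sym (Represents.roots-children ρ)) (children⁺ (j≢r , eq)))) j≢r

  pathLength : ∀ {i} → Star R i root → ℕ
  pathLength ε       = 0
  pathLength (_ ◅ p) = suc (pathLength p)

  pathLength-unique : ∀ {i} (p q : Star R i root) → pathLength p ≡ pathLength q
  pathLength-unique ε       ε        = refl
  pathLength-unique ε       (e ◅ _)  = ⊥-elim (R-root e)
  pathLength-unique (e ◅ _) ε        = ⊥-elim (R-root e)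
  pathLength-unique (e ◅ p) (e′ ◅ q) with refl ← R-functional e e′ = cong suc (pathLength-unique p q)

  depth : Fin n → ℕ
  depth i = pathLength (toRoot i)

  depth-child : ∀ {j i} → R j i → depth j ≡ suc (depth i)
  depth-child {j} {i} e = pathLength-unique (toRoot j) (e ◅ toRoot i)

  -- `k` bounds the height still to be explored: descending to a child lowers `k` by one and
  -- increases the depth by one. The sum of all depths is a convenient bound on each of them, which
  -- rules out `k` = 0 with a vertex left.
  grow : ∀ k cs → (∀ {c} → c ∈ cs → sum depth < k + depth c) → Σ[ t ∈ Forest n ] Spans cs t
  grow k       []       _    = leaf , leaf
  grow zero    (c ∷ cs) deep = ⊥-elim (ℕₚ.<⇒≱ (deep (here refl)) (≤-sum depth c))
    where
    ≤-sum : ∀ {m} (f : Fin m → ℕ) i → f i ≤ sum f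
    ≤-sum f zero    = ℕₚ.m≤m+n _ _
    ≤-sum f (suc i) = ≤-trans (≤-sum (f ∘ suc) i) (ℕₚ.m≤n+m _ (f zero))
  grow (suc k) (c ∷ cs) deep =
    let s , σ = grow k (children c) (λ c′∈ → ≤-trans (deep (here refl))
          (≤-reflexive (trans (sym (ℕₚ.+-suc k (depth c)))
              (cong (_+_ k) (sym (depth-child (children⁻ c′∈)))))))
        t , τ = grow (suc k) cs (deep ∘ there)
    in node c s t , node σ τ

  spans-edges : ∀ {v cs t} → (∀ {c} → c ∈ cs → R c v) → Spans cs t → Edges R v t
  spans-edges f leaf       = tt
  spans-edges f (node σ τ) = f (here refl) , spans-edges children⁻ σ , spans-edges (f ∘ there) τ

  spans-sorted : ∀ {cs t} → Descending cs → Spans cs t → Sorted t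
  spans-sorted _        leaf       = tt
  spans-sorted (c> ∷ d) (node σ τ) = head c> τ , spans-sorted (children-descending _) σ , spans-sorted d τ
    where
    head : ∀ {c cs t} → All (_<ᶠ c) cs → Spans cs t → HeadBelow c t
    head _        leaf       = tt
    head (lt ∷ _) (node _ _) = ℕₚ.<⇒≤ lt

  occ-children : ∀ {j p} → R j p → ∀ v → occ j (children v) ≡ 𝟙 (p ≟ v)
  occ-children {j} {p} e v with p ≟ v
  ... | yes refl = occ-∈ (children-unique p) (children⁺ e)
  ... | no  p≢v  = occ-∉ (λ j∈ → p≢v (R-functional e (children⁻ j∈)))

  -- Each vertex of the forest contributes its list of children.
  occ-spans : ∀ {j p cs t} → R j p → Spans cs t → occ j (labels t) ≡ occ j cs + occ p (labels t)
  occ-spans e leaf = refl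
  occ-spans {j} {p} e (node {x} {cs} {s} {t} σ τ) = begin
    𝟙 (j ≟ x) + occ j (labels s ++ labels t)
      ≡⟨ cong (_+_ (𝟙 (j ≟ x))) (trans (occ-++ j (labels s) (labels t))
             (cong₂ _+_ (occ-spans e σ) (occ-spans e τ))) ⟩
    𝟙 (j ≟ x) + ((occ j (children x) + occ p (labels s)) + (occ j cs + occ p (labels t)))
      ≡⟨ cong (λ k → 𝟙 (j ≟ x) + ((k + occ p (labels s)) + (occ j cs + occ p (labels t))))
             (occ-children e x) ⟩
    𝟙 (j ≟ x) + ((𝟙 (p ≟ x) + occ p (labels s)) + (occ j cs + occ p (labels t)))
      ≡⟨ lemma (𝟙 (j ≟ x)) (𝟙 (p ≟ x)) (occ p (labels s)) (occ j cs) (occ p (labels t)) ⟩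
    𝟙 (j ≟ x) + occ j cs + (𝟙 (p ≟ x) + (occ p (labels s) + occ p (labels t)))
      ≡⟨ cong (λ k → 𝟙 (j ≟ x) + occ j cs + (𝟙 (p ≟ x) + k)) (occ-++ p (labels s) (labels t)) ⟨
    𝟙 (j ≟ x) + occ j cs + (𝟙 (p ≟ x) + occ p (labels s ++ labels t)) ∎
    where
    open ≡-Reasoning
    lemma : ∀ a b c d e → a + ((b + c) + (d + e)) ≡ a + d + (b + (c + e))
    lemma = solve-∀

  root∉spans : ∀ {v cs t} → (∀ {c} → c ∈ cs → R c v) → Spans cs t → ¬ (root ∈ labels t)
  root∉spans f (node σ τ) (here refl) = R-root (f (here refl))
  root∉spans f (node {s = s} σ τ) (there r∈) with ∈-++⁻ (labels s) r∈
  ... | inj₁ r∈s = root∉spans children⁻ σ r∈s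
  ... | inj₂ r∈t = root∉spans (f ∘ there) τ r∈t

  -- In `root ∷ labels t` a vertex occurs as often as its parent. Following the path to the root,
  -- every vertex occurs as often as the root, that is, once.
  spans-spanning : ∀ {t} → Spans (children root) t → allFin n ↭ root ∷ labels t
  spans-spanning {t} σ = occ⇒↭ _ _ (λ j → trans (occ-∈ (Uniqueₚ.allFin⁺ n) (∈-tabulate⁺ j))
      (sym (once (toRoot j))))
    where
    once : ∀ {j} → Star R j root → occ j (root ∷ labels t) ≡ 1
    once ε = cong₂ _+_ (𝟙-yes (root ≟ root) refl) (occ-∉ (root∉spans children⁻ σ))
    once {j} (_◅_ {j = p} e path) = trans (cong₂ _+_ (𝟙-no (j ≟ root) (proj₁ e))
      (trans (occ-spans e σ) (cong (_+ occ p (labels t)) (occ-children e root)))) (once path)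

  represent : Σ[ t ∈ Forest n ] Represents t
  represent with t , σ ← grow (suc (sum depth)) (children root) (λ _ → ℕₚ.m≤m+n _ _) = t , record
    { sorted   = spans-sorted (children-descending root) σ
    ; spanning = spans-spanning σ
    ; edges    = spans-edges children⁻ σ
    }

-- The κ-number

sum-δ : (y : Fin n) (h : Fin n → ℕ) → ∑[ i < n ] (𝟙 (i ≟ y) * h i) ≡ h y
sum-δ {suc n} zero    h = trans (cong₂ _+_ (ℕₚ.*-identityˡ (h zero)) (sum-zero n)) (ℕₚ.+-identityʳ _)
  where
  sum-zero : ∀ n → ∑[ i < n ] 0 ≡ 0
  sum-zero zero    = refl
  sum-zero (suc n) = sum-zero n
sum-δ {suc n} (suc y) h = trans (sum-cong-≗ (λ i → cong (_* h (suc i)) (𝟙-suc i))) (sum-δ y (h ∘ suc))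
  where
  𝟙-suc : ∀ i → 𝟙 (suc i ≟ suc y) ≡ 𝟙 (i ≟ y)
  𝟙-suc i with i ≟ y
  ... | yes _ = refl
  ... | no  _ = refl

sum-occ : (L : List (Fin n)) (h : Fin n → ℕ) → ∑[ i < n ] (occ i L * h i) ≡ sumˡ (map h L)
sum-occ {n} []      h = trans (sym (*-distribˡ-sum 0 h)) refl
sum-occ {n} (y ∷ L) h = begin
  ∑[ i < n ] ((𝟙 (i ≟ y) + occ i L) * h i)                      ≡⟨ sum-cong-≗
      (λ i → ℕₚ.*-distribʳ-+ (h i) (𝟙 (i ≟ y)) (occ i L)) ⟩
  ∑[ i < n ] (𝟙 (i ≟ y) * h i + occ i L * h i)                  ≡⟨ ∑-distrib-+ (λ i → 𝟙 (i ≟ y) * h i)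
      (λ i → occ i L * h i) ⟩
  ∑[ i < n ] (𝟙 (i ≟ y) * h i) + ∑[ i < n ] (occ i L * h i)     ≡⟨ cong₂ _+_ (sum-δ y h) (sum-occ L h) ⟩
  h y + sumˡ (map h L)                                          ∎
  where open ≡-Reasoning

nonRoot-sum : {r : Fin n} {t : Forest n} → allFin n ↭ r ∷ labels t → (f : Fin n → ℕ) →
  ∑-nonRoot r (f ∘ proj₁) ≡ sumˡ (map f (labels t))
nonRoot-sum {n} {r} {t} p f = begin
  sum F                         ≡⟨ trans (sym (sum-tabulate F)) (cong sumˡ (sym (map-tabulate id F))) ⟩
  sumˡ (map F (allFin n))       ≡⟨ sum-↭ (map⁺ F p) ⟩
  F r + sumˡ (map F (labels t)) ≡⟨ cong₂ _+_ at-root (off-root (labels t) (spanning-nonRoot {t = t} p)) ⟩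
  sumˡ (map f (labels t))       ∎
  where
  open ≡-Reasoning
  F : Fin n → ℕ
  F i = when (¬? (i ≟ r)) (λ _ → f i)
  at-root : F r ≡ 0
  at-root with r ≟ r
  ... | yes _  = refl
  ... | no r≢r = ⊥-elim (r≢r refl)
  off-root : ∀ L → (∀ {j} → j ∈ L → j ≢ r) → sumˡ (map F L) ≡ sumˡ (map f L)
  off-root []      _   = refl
  off-root (j ∷ L) L≢r = cong₂ _+_ at-j (off-root L (L≢r ∘ there))
    where
    at-j : F j ≡ f j
    at-j with j ≟ r
    ... | yes j≡r = ⊥-elim (L≢r (here refl) j≡r)
    ... | no  _   = refl

when-cong : ∀ {P : Set} (d : Dec P) {f g : P → ℕ} → (∀ p → f p ≡ g p) → when d f ≡ when d g
when-cong (yes p) eq = eq p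
when-cong (no _)  _  = refl

when-* : ∀ {P : Set} (d : Dec P) b → when d (λ _ → b) ≡ 𝟙 d * b
when-* (yes _) b = sym (ℕₚ.*-identityˡ b)
when-* (no _)  b = refl

𝟙-×-dec : ∀ {P Q : Set} (p : Dec P) (q : Dec Q) → 𝟙 (p ×-dec q) ≡ 𝟙 p * 𝟙 q
𝟙-×-dec (yes _) (yes _) = refl
𝟙-×-dec (yes _) (no _)  = refl
𝟙-×-dec (no _)  _       = refl

-- Applied with `L` the chain of ancestors above a subforest and `js` the labels of that subforest.
cross : List (Fin n) → List (Fin n) → ℕ
cross L js = sumˡ (map (λ i → below i js) L)

cross-++ : (L js ks : List (Fin n)) → cross L (js ++ ks) ≡ cross L js + cross L ks
cross-++ []      js ks = refl
cross-++ (i ∷ L) js ks = trans (cong₂ _+_ (trans (cong sumˡ (map-++ _ js ks))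
    (sum-++ (map _ js) (map _ ks))) (cross-++ L js ks))
  (lemma (below i js) (below i ks) (cross L js) (cross L ks))
  where
  lemma : ∀ a b c d → a + b + (c + d) ≡ a + c + (b + d)
  lemma = solve-∀

cross-[] : (L : List (Fin n)) → cross L [] ≡ 0
cross-[] []      = refl
cross-[] (_ ∷ L) = cross-[] L

cross-∷ : (L : List (Fin n)) (x : Fin n) (js : List (Fin n)) →
  cross L (x ∷ js) ≡ sumˡ (map (λ i → 𝟙 (x <? i)) L) + cross L js
cross-∷ []      x js = refl
cross-∷ (i ∷ L) x js = trans (cong (_+_ (𝟙 (x <? i) + below i js)) (cross-∷ L x js))
  (lemma (𝟙 (x <? i)) (below i js) _ _)
  where
  lemma : ∀ a b c d → a + b + (c + d) ≡ a + c + (b + d)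
  lemma = solve-∀

module Kappa (T : RootedTree n) where
  open RootedTree T
  open Tree T

  -- A cycle through `j` also passes through the parent of `j`. Rotating it repeatedly moves it up
  -- to the root, which has no parent.
  acyclic : ∀ {j} → Star R j root → ¬ TransClosure R j j
  acyclic ε        [ e ]      = R-root e
  acyclic ε        (e ∷ _)    = R-root e
  acyclic (e ◅ p) [ e′ ]      with refl ← R-functional e e′ = acyclic p [ e′ ]
  acyclic (e ◅ p) (e′ ∷ cycle) with refl ← R-functional e e′ = acyclic p (cycle ∷ʳ e′)
    where
    _∷ʳ_ : ∀ {i j k} → TransClosure R i j → R j k → TransClosure R i k
    [ e ]     ∷ʳ e′ = e ∷ [ e′ ]
    (e ∷ es) ∷ʳ e′ = e ∷ (es ∷ʳ e′)

  -- The two terms never count the same vertex, because `x` is not an ancestor of itself.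
  ancestor-child : ∀ {y x} → R y x → ∀ i → 𝟙 (ancestor? i y) ≡ 𝟙 (i ≟ x) + 𝟙 (ancestor? i x)
  ancestor-child {y} {x} e i with i ≟ x
  ... | yes refl = trans (𝟙-yes (ancestor? i y) [ e ])
      (cong suc (sym (𝟙-no (ancestor? i i) (acyclic (toRoot i)))))
  ... | no  i≢x  = ℕₚ.≤-antisym (𝟙-mono (ancestor? i y) (ancestor? i x) down)
      (𝟙-mono (ancestor? i x) (ancestor? i y) (e ∷_))
    where
    down : Ancestor i y → Ancestor i x
    down [ e′ ]    = ⊥-elim (i≢x (R-functional e′ e))
    down (e′ ∷ es) with refl ← R-functional e′ e = es

  inverted : Fin n → Fin n → ℕ
  inverted i j = 𝟙 (ancestor? i j ×-dec (j <? i))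

  -- Inversions grouped by their descendant, whose ancestors form a single chain; `inversions`
  -- groups them by the ancestor instead.
  inversionsAt : Fin n → ℕ
  inversionsAt j = ∑[ i < n ] when (¬? (i ≟ root)) (λ _ → inverted i j)

  -- L lists v and its ancestors, except the root.
  Chain : Fin n → List (Fin n) → Set
  Chain v L = ∀ {x} → R x v → ∀ i → occ i L ≡ when (¬? (i ≟ root)) (λ _ → 𝟙 (ancestor? i x))

  chain-root : Chain root []
  chain-root {x} e i with i ≟ root
  ... | yes _  = refl
  ... | no i≢r = sym (𝟙-no (ancestor? i x) above-x)
    where
    above-x : ¬ Ancestor i x
    above-x [ e′ ]         = i≢r (R-functional e′ e)
    above-x (e′ ∷ [ e″ ])  with refl ← R-functional e′ e = R-root e″
    above-x (e′ ∷ (e″ ∷ _)) with refl ← R-functional e′ e = R-root e″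

  chain-child : ∀ {x v} L → R x v → Chain v L → Chain x (x ∷ L)
  chain-child {x} L e chain {y} e′ i = trans (cong (_+_ (𝟙 (i ≟ x))) (chain e i)) split
    where
    split : 𝟙 (i ≟ x) + when (¬? (i ≟ root)) (λ _ → 𝟙 (ancestor? i x)) ≡
      when (¬? (i ≟ root)) (λ _ → 𝟙 (ancestor? i y))
    split with i ≟ root
    ... | yes refl = trans (ℕₚ.+-identityʳ _) (𝟙-no (root ≟ x) (λ { refl → R-root e }))
    ... | no  _    = sym (ancestor-child e′ i)

  inversionsAt-chain : ∀ {x v} L → R x v → Chain v L → inversionsAt x ≡ sumˡ (map (λ i → 𝟙 (x <? i)) L)
  inversionsAt-chain {x} L e chain = trans (sum-cong-≗ pointwise) (sum-occ L (λ i → 𝟙 (x <? i)))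
    where
    pointwise : ∀ i → when (¬? (i ≟ root)) (λ _ → inverted i x) ≡ occ i L * 𝟙 (x <? i)
    pointwise i rewrite chain e i with i ≟ root
    ... | yes _ = refl
    ... | no  _ = 𝟙-×-dec (ancestor? i x) (x <? i)

  -- The upper vertex of an inversion lies either in `t` or on the chain above it. On entering `s`,
  -- the vertex `x` joins the chain, and its contribution to `cross` is the term
  -- `below x (labels s)` of `inversions`.
  inversions-below : ∀ {v} L t → Edges R v t → Chain v L →
    sumˡ (map inversionsAt (labels t)) ≡ inversions t + cross L (labels t)
  inversions-below L leaf         _             _     = sym (cross-[] L)
  inversions-below L (node x s t) (e , es , et) chain = begin
    inversionsAt x + sumˡ (map inversionsAt (labels s ++ labels t))
      ≡⟨ cong₂ _+_ (inversionsAt-chain L e chain)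
           (trans (cong sumˡ (map-++ inversionsAt (labels s) (labels t)))
               (sum-++ (map inversionsAt (labels s)) _)) ⟩
    above + (sumˡ (map inversionsAt (labels s)) + sumˡ (map inversionsAt (labels t)))
      ≡⟨ cong (_+_ above) (cong₂ _+_ (inversions-below (x ∷ L) s es (chain-child L e chain))
             (inversions-below L t et chain)) ⟩
    above + ((inversions s + (below x (labels s) + cross L (labels s))) + (inversions t + cross L (labels t)))
      ≡⟨ lemma above (inversions s) (below x (labels s)) (cross L (labels s)) (inversions t)
             (cross L (labels t)) ⟩
    below x (labels s) + (inversions s + inversions t) + (above + (cross L (labels s) + cross L (labels t)))
      ≡⟨ cong (_+_ (below x (labels s) + (inversions s + inversions t)))
           (trans (cross-∷ L x (labels s ++ labels t))
               (cong (_+_ above) (cross-++ L (labels s) (labels t)))) ⟨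
    below x (labels s) + (inversions s + inversions t) + cross L (x ∷ labels s ++ labels t) ∎
    where
    open ≡-Reasoning
    above = sumˡ (map (λ i → 𝟙 (x <? i)) L)
    lemma : ∀ a i b c j d → a + ((i + (b + c)) + (j + d)) ≡ b + (i + j) + (a + (c + d))
    lemma = solve-∀

  -- The parent of `i` differs from `j`, since otherwise `i` and `j` would be ancestors of each
  -- other; distinct vertices are joined by `b` edges.
  κ-summand : ∀ b (i : NonRoot root) j →
    when (ancestor? (proj₁ i) j ×-dec (j <? proj₁ i)) (λ _ → mult (complete n b) (parent i) j)
    ≡ inverted (proj₁ i) j * b
  κ-summand b (i , i≢r) j = trans (when-cong (ancestor? i j ×-dec (j <? i)) (λ (anc , _) → b-edges anc))
    (when-* (ancestor? i j ×-dec (j <? i)) b)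
    where
    b-edges : Ancestor i j → mult (complete n b) (parent (i , i≢r)) j ≡ b
    b-edges anc with parent (i , i≢r) ≟ j
    ... | yes eq = ⊥-elim (acyclic (toRoot i) ((i≢r , eq) ∷ anc))
    ... | no  _  = refl

  κ-complete : ∀ b t → Represents t → κ (complete n b) T ≡ inversions t * b
  κ-complete b t ρ = begin
    κ (complete n b) T
      ≡⟨ sum-cong-≗ (λ i → when-cong (¬? (i ≟ root))
             (λ i≢r → sum-cong-≗ (λ j → when-cong (¬? (j ≟ root)) (λ _ → κ-summand b (i , i≢r) j)))) ⟩
    ∑[ i < n ] when (¬? (i ≟ root)) (λ _ → ∑[ j < n ] when (¬? (j ≟ root)) (λ _ → inverted i j * b))
      ≡⟨ sum-cong-≗ (λ i → trans (when-* (¬? (i ≟ root)) _)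
             (trans (*-distribˡ-sum (𝟙 (¬? (i ≟ root))) (λ j → when (¬? (j ≟ root)) (λ _ → inverted i j * b)))
           (sum-cong-≗ (rearrange i)))) ⟩
    ∑[ i < n ] ∑[ j < n ] (b * (𝟙 (¬? (j ≟ root)) * when (¬? (i ≟ root)) (λ _ → inverted i j)))
      -- κ sums over the ancestor on the outside; the exchange groups the pairs by descendant.
      ≡⟨ ∑-comm (λ i j → b * (𝟙 (¬? (j ≟ root)) * when (¬? (i ≟ root)) (λ _ → inverted i j))) ⟩
    ∑[ j < n ] ∑[ i < n ] (b * (𝟙 (¬? (j ≟ root)) * when (¬? (i ≟ root)) (λ _ → inverted i j)))
      ≡⟨ sum-cong-≗ (λ j → trans (sym (*-distribˡ-sum b
             (λ i → 𝟙 (¬? (j ≟ root)) * when (¬? (i ≟ root)) (λ _ → inverted i j))))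
           (cong (b *_) (trans (sym (*-distribˡ-sum (𝟙 (¬? (j ≟ root)))
               (λ i → when (¬? (i ≟ root)) (λ _ → inverted i j))))
             (sym (when-* (¬? (j ≟ root)) (inversionsAt j)))))) ⟩
    ∑[ j < n ] (b * when (¬? (j ≟ root)) (λ _ → inversionsAt j))
      ≡⟨ *-distribˡ-sum b (λ j → when (¬? (j ≟ root)) (λ _ → inversionsAt j)) ⟨
    b * ∑-nonRoot root (inversionsAt ∘ proj₁)
      ≡⟨ cong (b *_) (nonRoot-sum {t = t} spanning inversionsAt) ⟩
    b * sumˡ (map inversionsAt (labels t))
      ≡⟨ cong (b *_) (trans (inversions-below [] t edges chain-root) (ℕₚ.+-identityʳ (inversions t))) ⟩
    b * inversions t
      ≡⟨ ℕₚ.*-comm b (inversions t) ⟩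
    inversions t * b ∎
    where
    open ≡-Reasoning
    open Represents ρ
    lemma : ∀ p q a b → p * (q * (a * b)) ≡ b * (q * (p * a))
    lemma = solve-∀
    rearrange : ∀ i j → 𝟙 (¬? (i ≟ root)) * when (¬? (j ≟ root)) (λ _ → inverted i j * b)
                      ≡ b * (𝟙 (¬? (j ≟ root)) * when (¬? (i ≟ root)) (λ _ → inverted i j))
    rearrange i j = trans (cong (𝟙 (¬? (i ≟ root)) *_) (when-* (¬? (j ≟ root)) (inverted i j * b)))
      (trans (lemma (𝟙 (¬? (i ≟ root))) (𝟙 (¬? (j ≟ root))) (inverted i j) b)
        (cong (λ k → b * (𝟙 (¬? (j ≟ root)) * k)) (sym (when-* (¬? (i ≟ root)) (inverted i j)))))

-- Spherical parking functions of the complete multigraph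

lookup-ext : {u v : Vec ℕ n} → (∀ i → lookup u i ≡ lookup v i) → u ≡ v
lookup-ext {u = u} {v} eq = trans (sym (Vecₚ.tabulate∘lookup u))
    (trans (Vecₚ.tabulate-cong eq) (Vecₚ.tabulate∘lookup v))

_∣ᵐ_ : Vec ℕ n → Vec ℕ n → Set
d ∣ᵐ e = ∀ i → lookup d i ≤ lookup e i

_∣ᵐ?_ : (d e : Vec ℕ n) → Dec (d ∣ᵐ e)
d ∣ᵐ? e = all? (λ i → lookup d i ℕₚ.≤? lookup e i)

-- Monomials in monomial ideals

module MonomialIdeal {c ℓ₁ ℓ₂} (𝕂 : HeytingField c ℓ₁ ℓ₂) (n : ℕ) where
  open Polynomials 𝕂 n
  private module K = HeytingField 𝕂

  -- Invertibility of a difference gives apartness. If 1 equalled 0, then 1 - 0 would equal 1 and be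
  -- invertible, so 1 would be apart from 0.
  1≉0 : ¬ (K.1# K.≈ K.0#)
  1≉0 1≈0 = K.#-irrefl 1≈0 (K.invertible⇒# (K.1# , left , right))
    where
    1-0 : K.1# K.- K.0# K.≈ K.1#
    1-0 = K.trans (K.+-congʳ 1≈0) (K.trans (K.-‿inverseʳ K.0#) (K.sym 1≈0))
    left : K.1# K.* (K.1# K.- K.0#) K.≈ K.1#
    left = K.trans (K.*-identityˡ _) 1-0
    right : (K.1# K.- K.0#) K.* K.1# K.≈ K.1#
    right = K.trans (K.*-identityʳ _) 1-0

  coeff-++ : ∀ p q e → coeff (p ++ q) e K.≈ coeff p e K.+ coeff q e
  coeff-++ []            q e = K.sym (K.+-identityˡ _)
  coeff-++ ((k , d) ∷ p) q e with Vecₚ.≡-dec ℕₚ._≟_ d e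
  ... | yes _ = K.trans (K.+-congˡ (coeff-++ p q e)) (K.sym (K.+-assoc _ _ _))
  ... | no  _ = coeff-++ p q e

  coeff-*x^ : ∀ f {d e} → ¬ (d ∣ᵐ e) → coeff (f *ₚ x^ d) e K.≈ K.0#
  coeff-*x^ []             _   = K.refl
  coeff-*x^ ((k , d′) ∷ f) {d} {e} d∤e with Vecₚ.≡-dec ℕₚ._≟_ (zipWith _+_ d′ d) e
  ... | yes refl = ⊥-elim (d∤e (λ i → ≤-trans (ℕₚ.m≤n+m _ (lookup d′ i))
      (≤-reflexive (sym (Vecₚ.lookup-zipWith _+_ i d′ d)))))
  ... | no  _    = coeff-*x^ f d∤e

  module _ {i} {I : Set i} (m : I → Vec ℕ n) where

    -- The case distinction is on divisibility of exponents, which is decidable, and not on the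
    -- vanishing of coefficients, which need not be decidable in a Heyting field.
    coeff-combination : ∀ e (fs : List (Poly × I)) →
      (∃ λ i → m i ∣ᵐ e) ⊎ coeff (foldr (λ (f , i) q → f *ₚ x^ (m i) +ₚ q) 0ₚ fs) e K.≈ K.0#
    coeff-combination e []             = inj₂ K.refl
    coeff-combination e ((f , i) ∷ fs) with m i ∣ᵐ? e | coeff-combination e fs
    ... | yes div | _        = inj₁ (i , div)
    ... | no _    | inj₁ div = inj₁ div
    ... | no ∤    | inj₂ z   = inj₂ (K.trans (coeff-++ (f *ₚ x^ (m i)) _ e)
      (K.trans (K.+-cong (coeff-*x^ f ∤) z) (K.+-identityˡ _)))

    x^∈⇒divides : ∀ e → x^ e ∈ᵖ ⟨ (λ i → x^ (m i)) ⟩ → ∃ λ i → m i ∣ᵐ e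
    x^∈⇒divides e (fs , eq) with coeff-combination e fs
    ... | inj₁ div = div
    ... | inj₂ z   = ⊥-elim (1≉0 (K.trans (K.sym lead) (K.trans (eq e) z)))
      where
      lead : coeff (x^ e) e K.≈ K.1#
      lead with Vecₚ.≡-dec ℕₚ._≟_ e e
      ... | yes _  = K.+-identityʳ _
      ... | no e≢e = ⊥-elim (e≢e refl)

    divides⇒x^∈ : ∀ e i → m i ∣ᵐ e → x^ e ∈ᵖ ⟨ (λ i → x^ (m i)) ⟩
    divides⇒x^∈ e i div = ((x^ (zipWith _∸_ e (m i)) , i) ∷ []) , equal
      where
      restore : zipWith _+_ (zipWith _∸_ e (m i)) (m i) ≡ e
      restore = lookup-ext (λ j → trans (Vecₚ.lookup-zipWith _+_ j (zipWith _∸_ e (m i)) (m i))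
        (trans (cong (_+ lookup (m i) j) (Vecₚ.lookup-zipWith _∸_ j e (m i))) (ℕₚ.m∸n+n≡m (div j))))
      equal : x^ e ≈ₚ x^ (zipWith _∸_ e (m i)) *ₚ x^ (m i) +ₚ 0ₚ
      equal e′ rewrite restore with Vecₚ.≡-dec ℕₚ._≟_ e e′
      ... | yes _ = K.+-congʳ (K.sym (K.*-identityˡ K.1#))
      ... | no  _ = K.refl

sum-∈ : (A : Subset n) (d : ∀ j → Dec (j ∈ˢ A)) → ∑[ j < n ] 𝟙 (d j) ≡ ∣ A ∣
sum-∈ Vec.[]            d = refl
sum-∈ (inside Vec.∷ A)  d = cong₂ _+_ (𝟙-yes (d zero) Vec.here)
  (trans (sum-cong-≗ (λ j → ℕₚ.≤-antisym (𝟙-mono (d (suc j)) (j ∈? A) Subsetₚ.drop-there)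
      (𝟙-mono (j ∈? A) (d (suc j)) Vec.there)))
         (sum-∈ A (_∈? A)))
sum-∈ (outside Vec.∷ A) d = cong₂ _+_ (𝟙-no (d zero) (λ ()))
  (trans (sum-cong-≗ (λ j → ℕₚ.≤-antisym (𝟙-mono (d (suc j)) (j ∈? A) Subsetₚ.drop-there)
      (𝟙-mono (j ∈? A) (d (suc j)) Vec.there)))
         (sum-∈ A (_∈? A)))

-- The root always lies outside `A` and gives `a`; each of the n - |A| other outside vertices gives
-- `b`.
outDegree-complete : ∀ a b (A : Subset n) i → i ∈ˢ A →
  outDegree (rootedComplete n a b) A i ≡ a + (n ∸ ∣ A ∣) * b
outDegree-complete {n} a b A i i∈A = cong (_+_ a) (begin
  ∑[ j < n ] when (outer j) (λ _ → completeMult n b i j)  ≡⟨ sum-cong-≗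
      (λ j → trans (when-cong (outer j) (b-edges j)) (when-* (outer j) b)) ⟩
  ∑[ j < n ] (𝟙 (outer j) * b)                            ≡⟨ *-distribʳ-sum b (λ j → 𝟙 (outer j)) ⟨
  (∑[ j < n ] 𝟙 (outer j)) * b                            ≡⟨ cong (_* b)
      (trans (sum-cong-≗ same) (sum-∈ (∁ A) (_∈? ∁ A))) ⟩
  ∣ ∁ A ∣ * b                                             ≡⟨ cong (_* b) (Subsetₚ.∣∁p∣≡n∸∣p∣ A) ⟩
  (n ∸ ∣ A ∣) * b                                         ∎)
  where
  open ≡-Reasoning
  outer : ∀ j → Dec (suc j ∈ˢ ∁ (outside Vec.∷ A))
  outer j = suc j ∈? ∁ (outside Vec.∷ A)
  same : ∀ j → 𝟙 (outer j) ≡ 𝟙 (j ∈? ∁ A)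
  same j = ℕₚ.≤-antisym (𝟙-mono (outer j) (j ∈? ∁ A) Subsetₚ.drop-there)
      (𝟙-mono (j ∈? ∁ A) (outer j) Vec.there)
  b-edges : ∀ j → suc j ∈ˢ ∁ (outside Vec.∷ A) → completeMult n b i j ≡ b
  b-edges j j∈ with i ≟ j
  ... | yes refl = ⊥-elim (Subsetₚ.x∈∁p⇒x∉p (Subsetₚ.drop-there j∈) i∈A)
  ... | no  _    = refl

module SphericalParking {c ℓ₁ ℓ₂} (𝕂 : HeytingField c ℓ₁ ℓ₂) (n a b : ℕ) (2≤n : 2 ≤ n) where
  open MonomialIdeal 𝕂 n
  G = rootedComplete n a b

  exponent : Subset n → Vec ℕ n
  exponent A = Vec.tabulate λ i → when (i ∈? A) (λ _ → outDegree G A i)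

  Dominates : Vec ℕ n → Subset n → Set
  Dominates 𝒫 A = ∀ i → i ∈ˢ A → a + (n ∸ ∣ A ∣) * b ≤ lookup 𝒫 i

  divides⇒dominates : ∀ 𝒫 {A} → exponent A ∣ᵐ 𝒫 → Dominates 𝒫 A
  divides⇒dominates 𝒫 {A} div i i∈A = subst (_≤ lookup 𝒫 i) (trans (Vecₚ.lookup∘tabulate _ i) at-i) (div i)
    where
    at-i : when (i ∈? A) (λ _ → outDegree G A i) ≡ a + (n ∸ ∣ A ∣) * b
    at-i with i ∈? A
    ... | yes _  = outDegree-complete a b A i i∈A
    ... | no i∉A = ⊥-elim (i∉A i∈A)

  dominates⇒divides : ∀ 𝒫 {A} → Dominates 𝒫 A → exponent A ∣ᵐ 𝒫
  dominates⇒divides 𝒫 {A} dom i = subst (_≤ lookup 𝒫 i) (sym (Vecₚ.lookup∘tabulate _ i)) at-i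
    where
    at-i : when (i ∈? A) (λ _ → outDegree G A i) ≤ lookup 𝒫 i
    at-i with i ∈? A
    ... | yes i∈A = subst (_≤ lookup 𝒫 i) (sym (outDegree-complete a b A i i∈A)) (dom i i∈A)
    ... | no  _   = z≤n

  -- As n is at least 2, `suc (n ∸ 2)` is n - 1: the generators of the skeleton ideal are exactly
  -- those of the nonempty proper subsets.
  <⇒≤ : ∀ {k} → k < n → k ≤ suc (n ∸ 2)
  <⇒≤ k<n = ℕₚ.≤-pred (≤-trans k<n (≤-reflexive (sym (ℕₚ.m+[n∸m]≡n 2≤n))))

  ≤⇒< : ∀ {k} → k ≤ suc (n ∸ 2) → k < n
  ≤⇒< k≤ = ≤-trans (s≤s k≤) (≤-reflexive (ℕₚ.m+[n∸m]≡n 2≤n))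

  -- The first condition is divisibility by the generator of the full set [n], the only one outside
  -- the skeleton ideal; its exponents are all `a`.
  Spherical : Vec ℕ n → Set
  Spherical 𝒫 = (∀ i → a ≤ lookup 𝒫 i) × (∀ A → Nonempty A → ∣ A ∣ < n → ¬ Dominates 𝒫 A)

  sPF⇒spherical : ∀ 𝒫 → sPF 𝕂 G 𝒫 → Spherical 𝒫
  sPF⇒spherical 𝒫 (∈M , ∉M) = a≤𝒫 , proper
    where
    proper : ∀ A → Nonempty A → ∣ A ∣ < n → ¬ Dominates 𝒫 A
    proper A ne A<n dom = ∉M (divides⇒x^∈ _ 𝒫 (A , ne , <⇒≤ A<n) (dominates⇒divides 𝒫 dom))
    a≤𝒫 : ∀ i → a ≤ lookup 𝒫 i
    a≤𝒫 i with (A , ne) , div ← x^∈⇒divides _ 𝒫 ∈M with ∣ A ∣ ℕₚ.<? n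
    ... | yes A<n = ⊥-elim (proper A ne A<n (divides⇒dominates 𝒫 div))
    ... | no  A≮n with refl ← Subsetₚ.∣p∣≡n⇒p≡⊤ {p = A} (ℕₚ.≤-antisym (Subsetₚ.∣p∣≤n A) (ℕₚ.≮⇒≥ A≮n)) =
      ≤-trans (ℕₚ.m≤m+n a _) (divides⇒dominates 𝒫 div i Subsetₚ.∈⊤)

  spherical⇒sPF : ∀ 𝒫 → Spherical 𝒫 → sPF 𝕂 G 𝒫
  spherical⇒sPF 𝒫 (a≤𝒫 , proper) =
    divides⇒x^∈ _ 𝒫 (⊤ˢ , nonempty 2≤n) (dominates⇒divides 𝒫 full) ,
    λ ∈M → let (A , ne , A≤) , div = x^∈⇒divides _ 𝒫 ∈M in proper A ne (≤⇒< A≤) (divides⇒dominates 𝒫 div)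
    where
    nonempty : ∀ {n} → 2 ≤ n → Nonempty (⊤ˢ {n})
    nonempty (s≤s _) = zero , Subsetₚ.∈⊤
    full : Dominates 𝒫 ⊤ˢ
    full i _ = ≤-trans (≤-reflexive (trans (cong (λ k → a + k * b)
        (trans (cong (n ∸_) (Subsetₚ.∣⊤∣≡n n)) (ℕₚ.n∸n≡0 n))) (ℕₚ.+-identityʳ a))) (a≤𝒫 i)

-- The bijection

edges-agree : {R S : Fin n → Fin n → Set} (v : Fin n) (t : Forest n) → Edges R v t → Edges S v t →
  ∀ {j} → j ∈ labels t → ∃ λ i → R j i × S j i
edges-agree v (node x s t) (e , _)      (f , _)      (here refl) = v , e , f
edges-agree v (node x s t) (_ , es , et) (_ , fs , ft) (there j∈) with ∈-++⁻ (labels s) j∈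
... | inj₁ j∈s = edges-agree x s es fs j∈s
... | inj₂ j∈t = edges-agree v t et ft j∈t

represents-transport : (S T : RootedTree n) → RootedTree.root S ≡ RootedTree.root T →
  (∀ i p q → RootedTree.parent S (i , p) ≡ RootedTree.parent T (i , q)) →
  ∀ {t} → Tree.Represents S t → Tree.Represents T t
represents-transport S T root-≡ parent-≡ {t} ρ = record
  { sorted   = Represents.sorted ρ
  ; spanning = subst (λ r → allFin _ ↭ r ∷ labels t) root-≡ (Represents.spanning ρ)
  ; edges    = subst (λ r → Edges (Tree.R T) r t) root-≡ (edges-map (root S) t
      (λ _ (p , eq) → let q = λ j≡r → p (trans j≡r (sym root-≡)) in q , trans (sym (parent-≡ _ p q)) eq)
          (Represents.edges ρ))
  }
  where
  open RootedTree
  open Tree S using (module Represents)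

represents-parents : (S T : RootedTree n) → RootedTree.root S ≡ RootedTree.root T → ∀ {t} →
  Tree.Represents S t → Tree.Represents T t →
  ∀ i p q → RootedTree.parent S (i , p) ≡ RootedTree.parent T (i , q)
represents-parents S T root-≡ {t} σ τ i p q
  with _ , (_ , eqₛ) , (_ , eqₜ) ← edges-agree (RootedTree.root S) t (Tree.Represents.edges σ)
         (subst (λ r → Edges (Tree.R T) r t) (sym root-≡) (Tree.Represents.edges τ))
         (spanning-complete {t = t} (Tree.Represents.spanning σ) p)
  = trans eqₛ (sym eqₜ)

-- The edge count and the passage to integers

sum-const : ∀ n k → ∑[ i < n ] k ≡ n * k
sum-const zero    k = refl
sum-const (suc n) k = cong (_+_ k) (sum-const n k)

𝟙-suc<suc : (i j : Fin n) → 𝟙 (suc i <? suc j) ≡ 𝟙 (i <? j)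
𝟙-suc<suc i j = ℕₚ.≤-antisym (𝟙-mono (suc i <? suc j) (i <? j) ℕₚ.≤-pred)
    (𝟙-mono (i <? j) (suc i <? suc j) s≤s)

sum-< : ∀ n → ∑[ i < n ] ∑[ j < n ] 𝟙 (i <? j) ≡ triangle n
sum-< zero    = refl
sum-< (suc n) = cong₂ _+_ (trans (sum-const n 1) (ℕₚ.*-identityʳ n))
  (trans rows (sum-< n))
  where
  rows : ∑[ i < n ] ∑[ j < n ] 𝟙 (suc i <? suc j) ≡ ∑[ i < n ] ∑[ j < n ] 𝟙 (i <? j)
  rows = sum-cong-≗ {n} (λ i → sum-cong-≗ {n} (λ j → 𝟙-suc<suc i j))

edgeCount-complete : ∀ n a b → edgeCount (rootedComplete n a b) ≡ n * a + triangle n * b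
edgeCount-complete n a b = cong₂ _+_ (sum-const n a) (begin
  ∑[ i < n ] ∑[ j < n ] when (suc i <? suc j) (λ _ → completeMult n b i j)
    ≡⟨ sum-cong-≗ (λ i → sum-cong-≗ (λ j → trans (when-cong (suc i <? suc j) (b-edges i j))
         (trans (when-* (suc i <? suc j) b) (cong (_* b) (𝟙-suc<suc i j))))) ⟩
  ∑[ i < n ] ∑[ j < n ] (𝟙 (i <? j) * b)
    ≡⟨ sum-cong-≗ {n} (λ i → *-distribʳ-sum {n} b (λ j → 𝟙 (i <? j))) ⟨
  ∑[ i < n ] ((∑[ j < n ] 𝟙 (i <? j)) * b)
    ≡⟨ *-distribʳ-sum {n} b (λ i → ∑[ j < n ] 𝟙 (i <? j)) ⟨
  (∑[ i < n ] ∑[ j < n ] 𝟙 (i <? j)) * b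
    ≡⟨ cong (_* b) (sum-< n) ⟩
  triangle n * b ∎)
  where
  open ≡-Reasoning
  b-edges : ∀ i j → suc i <ᶠ suc j → completeMult n b i j ≡ b
  b-edges i j i<j with i ≟ j
  ... | yes refl = ⊥-elim (ℕₚ.<-irrefl refl i<j)
  ... | no  _    = refl

opposite-sum : ∀ {b} (c : Fin b) → toℕ c + toℕ (opposite c) + 1 ≡ b
opposite-sum {b} c = trans (cong (λ k → toℕ c + k + 1) (Finₚ.opposite-prop c))
  (trans (lemma (toℕ c) _) (ℕₚ.m+[n∸m]≡n (Finₚ.toℕ<n c)))
  where
  lemma : ∀ x y → x + y + 1 ≡ suc x + y
  lemma = solve-∀

-- The genus is E - (n + 1) + 1 = E - n; the hypothesis is the required identity with the subtracted
-- terms moved to the other side, so that it can be proved in the natural numbers.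
balance : ∀ E n S w K → E + w + 1 ≡ K + S + n → ((((+ E - + suc n) +ℤ + 1) - + S) +ℤ + w) +ℤ + 1 ≡ + K
balance E n S w K eq = trans (lemma₁ (+ E) (+ n) (+ S) (+ w))
  (trans (cong (λ k → + k - (+ S +ℤ + n)) eq) (lemma₂ (+ K) (+ S) (+ n)))
  where
  lemma₁ : ∀ e n s w → ((((e - (+ 1 +ℤ n)) +ℤ + 1) - s) +ℤ w) +ℤ + 1 ≡ ((e +ℤ w) +ℤ + 1) - (s +ℤ n)
  lemma₁ = ℤSolver.solve-∀
  lemma₂ : ∀ k s n → ((k +ℤ s) +ℤ n) - (s +ℤ n) ≡ k
  lemma₂ = ℤSolver.solve-∀

-- Quotients, remainders and the correspondence

module _ (n a b : ℕ) .{{_ : NonZero b}} where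

  shifted : Vec ℕ n → Fin n → ℕ
  shifted 𝒫 i = lookup 𝒫 i ∸ a

  quot : Vec ℕ n → Fin n → ℕ
  quot 𝒫 i = shifted 𝒫 i / b

  rem : Vec ℕ n → Fin n → Fin b
  rem 𝒫 i = shifted 𝒫 i mod b

  quot-rem : ∀ 𝒫 i → a ≤ lookup 𝒫 i → lookup 𝒫 i ≡ a + (toℕ (rem 𝒫 i) + quot 𝒫 i * b)
  quot-rem 𝒫 i a≤ = trans (sym (ℕₚ.m+[n∸m]≡n a≤)) (cong (_+_ a) (trans (DivMod.m≡m%n+[m/n]*n (shifted 𝒫 i) b)
    (cong (_+ quot 𝒫 i * b) (sym (Finₚ.toℕ-fromℕ< (DivMod.m%n<n (shifted 𝒫 i) b))))))

  assemble : (Fin n → ℕ) → (Fin n → Fin b) → Vec ℕ n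
  assemble q c = Vec.tabulate (λ i → a + (toℕ (c i) + q i * b))

  shifted-assemble : ∀ q c i → shifted (assemble q c) i ≡ toℕ (c i) + q i * b
  shifted-assemble q c i = trans (cong (_∸ a) (Vecₚ.lookup∘tabulate _ i)) (ℕₚ.m+n∸m≡n a _)

  quot-assemble : ∀ q c i → quot (assemble q c) i ≡ q i
  quot-assemble q c i = trans (cong (_/ b) (shifted-assemble q c i))
    (trans (DivMod.+-distrib-/-∣ʳ (toℕ (c i)) (Divisibility.n∣m*n (q i)))
      (cong₂ _+_ (DivMod.m<n⇒m/n≡0 (Finₚ.toℕ<n (c i))) (DivMod.m*n/n≡m (q i) b)))

  rem-assemble : ∀ q c i → rem (assemble q c) i ≡ c i
  rem-assemble q c i = Finₚ.toℕ-injective (trans (Finₚ.toℕ-fromℕ< (DivMod.m%n<n (shifted (assemble q c) i) b))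
    (trans (cong (_% b) (shifted-assemble q c i))
        (trans (DivMod.[m+kn]%n≡m%n (toℕ (c i)) (q i) b) (DivMod.m<n⇒m%n≡m (Finₚ.toℕ<n (c i))))))

  ≤-quot : ∀ k 𝒫 i → a ≤ lookup 𝒫 i → k ≤ quot 𝒫 i → a + k * b ≤ lookup 𝒫 i
  ≤-quot k 𝒫 i a≤ k≤ = ≤-trans (ℕₚ.+-monoʳ-≤ a (≤-trans (ℕₚ.*-monoˡ-≤ b k≤) (DivMod.m/n*n≤m (shifted 𝒫 i) b)))
    (≤-reflexive (ℕₚ.m+[n∸m]≡n a≤))

  quot-≥ : ∀ k 𝒫 i → a + k * b ≤ lookup 𝒫 i → k ≤ quot 𝒫 i
  quot-≥ k 𝒫 i le = ≤-trans (≤-reflexive (sym (DivMod.m*n/n≡m k b)))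
    (DivMod./-monoˡ-≤ b (≤-trans (≤-reflexive (sym (ℕₚ.m+n∸m≡n a (k * b)))) (ℕₚ.∸-monoˡ-≤ a le)))

  -- The bijection as a relation. The remainders enter `rsum` with a minus sign: off the root this
  -- must match a label on the other side, hence the complement b - 1 - c(j), while at the root it
  -- cancels against the weight, which is therefore c(r) itself.
  record Corresponds (𝒫 : Vec ℕ n) (U : 𝒰 n b) : Set where
    open 𝒰 U
    field
      forest     : Forest n
      represents : Tree.Represents tree forest
      code       : Code (quot 𝒫) root forest
      label-rem  : ∀ j p → label (j , p) ≡ opposite (rem 𝒫 j)
      weight-rem : weight ≡ rem 𝒫 root

  prime⇒corresponds : ∀ 𝒫 → 2 ≤ n → Prime (quot 𝒫) → Σ[ U ∈ 𝒰 n b ] Corresponds 𝒫 U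
  prime⇒corresponds 𝒫 2≤n prime with r , t , code ← prime-code 2≤n prime = U , record
    { forest = t ; represents = ρ ; code = code ; label-rem = λ _ _ → refl ; weight-rem = refl }
    where
    T = forestTree r t (Code.labels-↭ code)
    ρ : Tree.Represents T t
    ρ = record
      { sorted   = Code.sorted code
      ; spanning = Code.labels-↭ code
      ; edges    = forest-edges r t (Code.labels-↭ code)
      }
    U : 𝒰 n b
    U = record
      { tree     = T
      ; uprooted = Tree.head⇒uprooted T t ρ (Code.head code)
      ; label    = λ (j , _) → opposite (rem 𝒫 j)
      ; weight   = rem 𝒫 r
      }

  corresponds-functional : ∀ {𝒫 U V} → Corresponds 𝒫 U → Corresponds 𝒫 V → U ≈ᵤ V
  corresponds-functional {𝒫} {U} {V} μ ν with root-≡ , t-≡ ← code-unique (Corresponds.code μ)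
      (Corresponds.code ν) = record
    { root-≡   = root-≡
    ; parent-≡ = represents-parents (𝒰.tree U) (𝒰.tree V) root-≡ (Corresponds.represents μ)
        (subst (Tree.Represents (𝒰.tree V)) (sym t-≡) (Corresponds.represents ν))
    ; label-≡  = λ i p q → trans (Corresponds.label-rem μ i p) (sym (Corresponds.label-rem ν i q))
    ; weight-≡ = trans (Corresponds.weight-rem μ)
        (trans (cong (rem 𝒫) root-≡) (sym (Corresponds.weight-rem ν)))
    }

  -- Equal trees have the same sorted forest, hence the same entries and quotients; weights and
  -- labels give back the remainders.
  corresponds-injective : ∀ {𝒫 𝒬 U V} → (∀ i → a ≤ lookup 𝒫 i) → (∀ i → a ≤ lookup 𝒬 i) →
    Corresponds 𝒫 U → Corresponds 𝒬 V → U ≈ᵤ V → 𝒫 ≡ 𝒬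
  corresponds-injective {𝒫} {𝒬} {U} {V} a≤𝒫 a≤𝒬 μ ν U≈V = lookup-ext (λ i →
    trans (quot-rem 𝒫 i (a≤𝒫 i)) (trans (cong₂ (λ c q → a + (toℕ c + q * b)) (rem-≡ i) (quot-≡ i))
        (sym (quot-rem 𝒬 i (a≤𝒬 i)))))
    where
    open _≈ᵤ_ U≈V
    t-≡ : Corresponds.forest μ ≡ Corresponds.forest ν
    t-≡ = Tree.represents-unique (𝒰.tree V)
      (represents-transport (𝒰.tree U) (𝒰.tree V) root-≡ parent-≡ (Corresponds.represents μ))
          (Corresponds.represents ν)
    quot-≡ : ∀ i → quot 𝒫 i ≡ quot 𝒬 i
    quot-≡ = code-function (subst₂ (Code (quot 𝒫)) root-≡ t-≡ (Corresponds.code μ)) (Corresponds.code ν)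
    rem-≡ : ∀ i → rem 𝒫 i ≡ rem 𝒬 i
    rem-≡ i with i ≟ 𝒰.root U
    ... | yes refl = trans (sym (Corresponds.weight-rem μ))
        (trans weight-≡ (trans (Corresponds.weight-rem ν) (cong (rem 𝒬) (sym root-≡))))
    ... | no  i≢r  = trans (sym (Finₚ.opposite-involutive (rem 𝒫 i))) (trans (cong opposite
            (trans (sym (Corresponds.label-rem μ i i≢r))
                (trans (label-≡ i i≢r i≢r′) (Corresponds.label-rem ν i i≢r′))))
          (Finₚ.opposite-involutive (rem 𝒬 i)))
      where
      i≢r′ : i ≢ 𝒰.root V
      i≢r′ i≡r = i≢r (trans i≡r (sym root-≡))

  remainders : 𝒰 n b → Fin n → Fin b
  remainders U i with i ≟ 𝒰.root U
  ... | yes _  = 𝒰.weight U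
  ... | no i≢r = opposite (𝒰.label U (i , i≢r))

  corresponds-surjective : ∀ U → Σ[ q ∈ (Fin n → ℕ) ] Prime q × Corresponds (assemble q (remainders U)) U
  corresponds-surjective U
    with t , ρ ← Tree.represent (𝒰.tree U)
    with q , code ← forest-code (Tree.Represents.sorted ρ)
        (Tree.uprooted⇒head (𝒰.tree U) (𝒰.uprooted U) t ρ) (Tree.Represents.spanning ρ)
    = q , code-prime code , record
    { forest     = t
    ; represents = ρ
    ; code       = record
        { sorted = Code.sorted code
        ; head   = Code.head code
        ; perm   = subst (_↭ _) (tabulate-cong (λ i → cong (i ,_) (sym (quot-assemble q c i))))
            (Code.perm code)
        }
    ; label-rem  = λ j p → sym (trans (cong opposite (trans (rem-assemble q c j) (off-root j p)))
        (Finₚ.opposite-involutive _))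
    ; weight-rem = sym (trans (rem-assemble q c (𝒰.root U)) at-root)
    }
    where
    c = remainders U
    at-root : c (𝒰.root U) ≡ 𝒰.weight U
    at-root with 𝒰.root U ≟ 𝒰.root U
    ... | yes _  = refl
    ... | no r≢r = ⊥-elim (r≢r refl)
    off-root : ∀ j p → c j ≡ opposite (𝒰.label U (j , p))
    off-root j p with j ≟ 𝒰.root U
    ... | yes j≡r = ⊥-elim (p j≡r)
    ... | no  _   = refl

  -- Each vertex off the root has remainder and label adding up to b - 1; the term `size t` supplies
  -- the missing ones.
  label-sum : ∀ c (r : Fin n) t → allFin n ↭ r ∷ labels t →
    sum (toℕ ∘ c) + ∑-nonRoot r (λ (j , _) → toℕ (opposite {b} (c j))) + size t ≡ toℕ (c r) + size t * b
  label-sum c r t p = trans (cong₂ (λ x y → x + y + size t) all-c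
      (nonRoot-sum {t = t} p (toℕ ∘ opposite ∘ c)))
    (trans (regroup (toℕ (c r)) _ _ (size t)) (cong (_+_ (toℕ (c r)))
      (subst (λ k → sumˡ (map (toℕ ∘ c) (labels t)) + sumˡ (map (toℕ ∘ opposite ∘ c) (labels t)) + k ≡ k * b)
        (length-labels t) (pairs (labels t)))))
    where
    all-c : sum (toℕ ∘ c) ≡ toℕ (c r) + sumˡ (map (toℕ ∘ c) (labels t))
    all-c = trans (trans (sym (sum-tabulate (toℕ ∘ c))) (cong sumˡ (sym (map-tabulate id (toℕ ∘ c)))))
        (sum-↭ (map⁺ (toℕ ∘ c) p))
    regroup : ∀ w x y s → w + x + y + s ≡ w + (x + y + s)
    regroup = solve-∀
    pairs : ∀ L → sumˡ (map (toℕ ∘ c) L) + sumˡ (map (toℕ ∘ opposite ∘ c) L) + length L ≡ length L * b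
    pairs []      = refl
    pairs (j ∷ L) = trans (lemma (toℕ (c j)) _ (toℕ (opposite (c j))) _ (length L))
        (cong₂ _+_ (opposite-sum (c j)) (pairs L))
      where
      lemma : ∀ x X y Y l → x + X + (y + Y) + suc l ≡ (x + y + 1) + (X + Y + l)
      lemma = solve-∀

  sum-𝒫 : ∀ 𝒫 → (∀ i → a ≤ lookup 𝒫 i) → sum (lookup 𝒫) ≡ n * a + (sum (toℕ ∘ rem 𝒫) + sum (quot 𝒫) * b)
  sum-𝒫 𝒫 a≤ = trans (sum-cong-≗ (λ i → quot-rem 𝒫 i (a≤ i)))
    (trans (∑-distrib-+ (λ _ → a) (λ i → toℕ (rem 𝒫 i) + quot 𝒫 i * b))
      (cong₂ _+_ (sum-const n a) (trans (∑-distrib-+ (toℕ ∘ rem 𝒫) (λ i → quot 𝒫 i * b))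
        (cong (_+_ (sum (toℕ ∘ rem 𝒫))) (sym (*-distribʳ-sum b (quot 𝒫)))))))

  -- With m = n - 1, the multiple `triangle n * b` splits into `triangle m * b`, covered by the
  -- quotients and the inversions, and `m * b`, covered by remainders and labels off the root.
  statistic : ∀ {𝒫 U} → (∀ i → a ≤ lookup 𝒫 i) → Corresponds 𝒫 U →
    edgeCount (rootedComplete n a b) + toℕ (𝒰.weight U) + 1 ≡
      κ (complete n b) (𝒰.tree U) + 𝒰.labelSum U + sum (lookup 𝒫) + n
  statistic {𝒫} {U} a≤ μ = begin
    edgeCount (rootedComplete n a b) + toℕ weight + 1
      ≡⟨ cong₂ (λ x y → x + toℕ y + 1) (edgeCount-complete n a b) weight-rem ⟩
    n * a + triangle n * b + ω + 1
      ≡⟨ cong (λ k → n * a + triangle k * b + ω + 1) n≡ ⟩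
    n * a + (m + triangle m) * b + ω + 1
      ≡⟨ lemma₁ (n * a) m (triangle m) b ω ⟩
    n * a + triangle m * b + (ω + m * b) + 1
      ≡⟨ cong₂ (λ x y → n * a + x * b + y + 1)
             (sym (total-entries t (AllPairs.tail (spanning-unique {t = t} (Code.labels-↭ code)))))
           (sym (label-sum (rem 𝒫) root t (Code.labels-↭ code))) ⟩
    n * a + (total (entries t) + inversions t) * b + (sum (toℕ ∘ rem 𝒫) + L + m) + 1
      ≡⟨ lemma₂ (n * a) (total (entries t)) (inversions t) b (sum (toℕ ∘ rem 𝒫)) L m ⟩
    inversions t * b + L + (n * a + (sum (toℕ ∘ rem 𝒫) + total (entries t) * b)) + suc m
      ≡⟨ cong₂ (λ x y → inversions t * b + L + x + y)
           (sym (trans (sum-𝒫 𝒫 a≤) (cong (λ k → n * a + (sum (toℕ ∘ rem 𝒫) + k * b))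
               (Code.sum-entries code)))) (sym n≡) ⟩
    inversions t * b + L + sum (lookup 𝒫) + n
      ≡⟨ cong₂ (λ x y → x + y + sum (lookup 𝒫) + n) (sym (Kappa.κ-complete tree b t represents))
           (sum-cong-≗ {n} (λ i → when-cong (¬? (i ≟ root)) (λ p → cong toℕ (sym (label-rem i p))))) ⟩
    κ (complete n b) tree + labelSum + sum (lookup 𝒫) + n ∎
    where
    open ≡-Reasoning
    open 𝒰 U
    open Corresponds μ renaming (forest to t)
    m = size t
    ω = toℕ (rem 𝒫 root)
    L = ∑-nonRoot root (λ (j , _) → toℕ (opposite (rem 𝒫 j)))
    n≡ : n ≡ suc m
    n≡ = size-labels {t = t} (Code.labels-↭ code)
    lemma₁ : ∀ x m t b w → x + (m + t) * b + w + 1 ≡ x + t * b + (w + m * b) + 1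
    lemma₁ = solve-∀
    lemma₂ : ∀ x e i b s l m → x + (e + i) * b + (s + l + m) + 1 ≡ i * b + l + (x + (s + e * b)) + suc m
    lemma₂ = solve-∀

  rsum-statistic : ∀ {𝒫 U} → (∀ i → a ≤ lookup 𝒫 i) → Corresponds 𝒫 U →
    (rsum (rootedComplete n a b) 𝒫 +ℤ + toℕ (𝒰.weight U)) +ℤ + 1 ≡
      + (κ (complete n b) (𝒰.tree U) + 𝒰.labelSum U)
  rsum-statistic {𝒫} {U} a≤ μ = balance (edgeCount (rootedComplete n a b)) n (sum (lookup 𝒫))
    (toℕ (𝒰.weight U)) (κ (complete n b) (𝒰.tree U) + 𝒰.labelSum U) (statistic a≤ μ)

module _ {c ℓ₁ ℓ₂} (𝕂 : HeytingField c ℓ₁ ℓ₂) (n a b : ℕ) .{{_ : NonZero b}} (2≤n : 2 ≤ n) where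
  open SphericalParking 𝕂 n a b 2≤n

  image : ((𝒫 , _) : ∃ (sPF 𝕂 G)) → Σ[ U ∈ 𝒰 n b ] Corresponds n a b 𝒫 U
  image (𝒫 , sp) = let a≤𝒫 , proper = sPF⇒spherical 𝒫 sp in prime⇒corresponds n a b 𝒫 2≤n
    (λ A ne A<n large → proper A ne A<n (λ i i∈A → ≤-quot n a b (n ∸ ∣ A ∣) 𝒫 i (a≤𝒫 i) (large i i∈A)))

  assemble-sPF : ∀ q c → Prime q → sPF 𝕂 G (assemble n a b q c)
  assemble-sPF q c prime = spherical⇒sPF (assemble n a b q c)
    ( (λ i → ≤-trans (ℕₚ.m≤m+n a _) (≤-reflexive
        (sym (Vecₚ.lookup∘tabulate (λ i → a + (toℕ (c i) + q i * b)) i))))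
    , λ A ne A<n dom → prime A ne A<n (λ i i∈A →
        subst (n ∸ ∣ A ∣ ≤_) (quot-assemble n a b q c i)
            (quot-≥ n a b (n ∸ ∣ A ∣) (assemble n a b q c) i (dom i i∈A))))

  φ : ∃ (sPF 𝕂 G) → 𝒰 n b
  φ 𝒫 = proj₁ (image 𝒫)

  φ-corresponds : ∀ 𝒫 → Corresponds n a b (proj₁ 𝒫) (φ 𝒫)
  φ-corresponds 𝒫 = proj₂ (image 𝒫)

  φ-cong : ∀ {𝒫 𝒬} → proj₁ 𝒫 ≡ proj₁ 𝒬 → φ 𝒫 ≈ᵤ φ 𝒬
  φ-cong {𝒫} {𝒬} eq = corresponds-functional n a b {U = φ 𝒫} {φ 𝒬}
    (subst (λ v → Corresponds n a b v (φ 𝒫)) eq (φ-corresponds 𝒫)) (φ-corresponds 𝒬)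

  φ-injective : ∀ {𝒫 𝒬} → φ 𝒫 ≈ᵤ φ 𝒬 → proj₁ 𝒫 ≡ proj₁ 𝒬
  φ-injective {𝒫 , sp} {𝒬 , sq} = corresponds-injective n a b {U = φ (𝒫 , sp)} {φ (𝒬 , sq)}
    (proj₁ (sPF⇒spherical 𝒫 sp)) (proj₁ (sPF⇒spherical 𝒬 sq)) (φ-corresponds (𝒫 , sp))
        (φ-corresponds (𝒬 , sq))

  φ-surjective : ∀ U → Σ[ 𝒫 ∈ ∃ (sPF 𝕂 G) ] (∀ {𝒬} → proj₁ 𝒬 ≡ proj₁ 𝒫 → φ 𝒬 ≈ᵤ U)
  φ-surjective U = (assemble n a b q rems , assemble-sPF q rems (proj₁ (proj₂ preimage))) ,
    λ {𝒬} eq → corresponds-functional n a b {U = φ 𝒬} {U}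
      (subst (λ v → Corresponds n a b v (φ 𝒬)) eq (φ-corresponds 𝒬)) (proj₂ (proj₂ preimage))
    where
    preimage = corresponds-surjective n a b U
    q = proj₁ preimage
    rems = remainders n a b U

  bijection : Bijection (sPF-setoid 𝕂 G) (𝒰-setoid n b)
  bijection = record
    { to        = φ
    ; cong      = λ {𝒫} {𝒬} → φ-cong {𝒫} {𝒬}
    ; bijective = (λ {𝒫} {𝒬} → φ-injective {𝒫} {𝒬}) , φ-surjective
    }

theorem2p11 : ∀ {c ℓ₁ ℓ₂} (𝕂 : HeytingField c ℓ₁ ℓ₂) (n a b : ℕ) → 2 ≤ n → 1 ≤ a → 1 ≤ b →
    Σ[ φ ∈ Bijection (sPF-setoid 𝕂 (rootedComplete n a b)) (𝒰-setoid n b) ]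
    ((𝒫 : ∃ (sPF 𝕂 (rootedComplete n a b))) →
    let T = Bijection.to φ 𝒫 in
    (rsum (rootedComplete n a b) (proj₁ 𝒫) +ℤ + toℕ (𝒰.weight T)) +ℤ + 1
    ≡ + (κ (complete n b) (𝒰.tree T) + 𝒰.labelSum T))
theorem2p11 𝕂 n a b 2≤n _ 1≤b = bijection 𝕂 n a b 2≤n , λ 𝒫 →
  rsum-statistic n a b {proj₁ 𝒫} {Bijection.to (bijection 𝕂 n a b 2≤n) 𝒫} (a≤ 𝒫) (φ-corresponds 𝕂 n a b 2≤n 𝒫)
  where
  instance _ = >-nonZero 1≤b
  a≤ : ((𝒫 , _) : ∃ (sPF 𝕂 (rootedComplete n a b))) → ∀ i → a ≤ lookup 𝒫 i
  a≤ (𝒫 , sp) = proj₁ (SphericalParking.sPF⇒spherical 𝕂 n a b 2≤n 𝒫 sp)
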